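{- For every finite connected weighted graph $G=(V,E,w)$ with $|V|=n\ge2$ and $w:E\to\mathbb{R}_{>0}$, $$\frac{\operatorname{OPT}_D(G,w)}{\operatorname{OPT}_{\mathrm{free}}(G,w)}\le\frac{2(n+1)}{3}.$$ The factor is best possible and is attained by the unweighted complete graph $K_n$ (all edge weights equal to $1$).
   Context: $d_G$ is the shortest-path metric of the support graph $(V,E)$ with every edge of length $1$; the weights are not edge lengths. An ultrametric on $V$ is a metric $u$ with $u(x,y)\le\max\{u(x,z),u(z,y)\}$ for all $x,y,z$. $\operatorname{OPT}_{\mathrm{free}}(G,w)$ is the minimum of $\sum_{xy\in E}w_{xy}u(x,y)$ over all ultrametrics $u$ on $V$ with $u(x,y)\ge d_G(x,y)$ for all $x,y\in V$ (the minimum is attained). A rooted binary hierarchy $T$ on $V$ is a rooted tree whose leaves are the vertices of $V$ and whose internal nodes have exactly two children; each node is identified with the set of leaves below it (a cluster), and $C_T(x,y)$ is the cluster of the lowest common ancestor of $x,y$. $\operatorname{OPT}_D(G,w)$ is the minimum of the standard Dasgupta cost $\sum_{xy\in E}w_{xy}|C_T(x,y)|$ over all rooted binary hierarchies $T$ on $V$. -}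

module Defs where

open import Data.Bool.Base using (if_then_else_)
open import Data.Fin.Base using (Fin) renaming (_<_ to _<ᶠ_)
import Data.Fin.Properties as Fin
open import Data.Integer.Base using (+_)
open import Data.List.Base using (List; []; _∷_; _++_; length; allFin)
open import Data.List.Relation.Binary.Permutation.Propositional using (_↭_)
open import Data.Nat.Base as ℕ using (ℕ; suc)
import Data.Nat.Properties as ℕ
open import Data.Product.Base using (Σ; ∃; ∃₂; _×_; _,_; proj₁; proj₂)
open import Data.Rational.Base hiding (truncate)
open import Data.Rational.Properties
open import Data.Rational.Solver using (module +-*-Solver)
open import Data.Sum.Base using (inj₁; inj₂)
open import Algebra.Bundles.Raw using (RawMonoid)
import Algebra.Definitions.RawMonoid as RawMonoidDefinitions
open import Level using (0ℓ)
open import Relation.Binary.PropositionalEquality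
  using (_≡_; _≢_; refl; sym; trans; cong; cong₂; subst; subst₂; ≢-sym)
open import Relation.Nullary.Decidable using (Dec; yes; no; does; ¬?; _×-dec_)

-- Reals are Cauchy sequences of rationals; their equality is _≈ᴿ_, not _≡_.

IsCauchy : (ℕ → ℚ) → Set
IsCauchy x = ∀ ε → 0ℚ < ε →
  ∃ λ N → ∀ m n → N ℕ.≤ m → N ℕ.≤ n → ∣ x m - x n ∣ < ε

record ℝ : Set where
  constructor mkℝ
  field
    seq    : ℕ → ℚ
    cauchy : IsCauchy seq

open ℝ public

infix  4 _≈ᴿ_ _≤ᴿ_ _<ᴿ_
infixl 6 _+ᴿ_ _⊔ᴿ_
infixl 7 _*ᴿ_

_≈ᴿ_ : ℝ → ℝ → Set
x ≈ᴿ y = ∀ ε → 0ℚ < ε → ∃ λ N → ∀ n → N ℕ.≤ n → ∣ seq x n - seq y n ∣ < ε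

_≤ᴿ_ : ℝ → ℝ → Set
x ≤ᴿ y = ∀ ε → 0ℚ < ε → ∃ λ N → ∀ n → N ℕ.≤ n → seq x n < seq y n + ε

_<ᴿ_ : ℝ → ℝ → Set
x <ᴿ y = ∃ λ ε → 0ℚ < ε × ∃ λ N → ∀ n → N ℕ.≤ n → seq x n + ε ≤ seq y n

module CauchyLemmas where
  half-pos : ∀ {ε} → 0ℚ < ε → 0ℚ < ε * ½
  half-pos {ε} 0<ε =
    subst (_< ε * ½) (*-zeroˡ ½) (*-monoˡ-<-pos ½ 0<ε)

  halves : ∀ ε → ε * ½ + ε * ½ ≡ ε
  halves ε = trans (sym (*-distribˡ-+ ε ½ ½)) (*-identityʳ ε)

  pos*pos : ∀ {p q} → 0ℚ < p → 0ℚ < q → 0ℚ < p * q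
  pos*pos {p} {q} 0<p 0<q = positive⁻¹ (p * q) {{pos*pos⇒pos p {{positive 0<p}} q {{positive 0<q}}}}

  ∣p-p∣≡0 : ∀ p → ∣ p - p ∣ ≡ 0ℚ
  ∣p-p∣≡0 p = cong ∣_∣ (+-inverseʳ p)

  p≤∣p∣ : ∀ p → p ≤ ∣ p ∣
  p≤∣p∣ p with ≤-total 0ℚ p
  ... | inj₁ 0≤p = ≤-reflexive (sym (0≤p⇒∣p∣≡p 0≤p))
  ... | inj₂ p≤0 = ≤-trans p≤0 (0≤∣p∣ p)

  ∣p-q∣≡∣q-p∣ : ∀ p q → ∣ p - q ∣ ≡ ∣ q - p ∣
  ∣p-q∣≡∣q-p∣ p q = trans (sym (∣-p∣≡∣p∣ (p - q))) (cong ∣_∣ (lemma p q))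
    where
    open +-*-Solver
    lemma : ∀ p q → - (p - q) ≡ q - p
    lemma = solve 2 (λ p q → :- (p :- q) := q :- p) refl

  distance⇒< : ∀ p q {ε} → ∣ p - q ∣ < ε → p < q + ε
  distance⇒< p q {ε} d = subst (_< q + ε) (lemma q p)
      (+-monoʳ-< q (≤-<-trans (p≤∣p∣ (p - q)) d))
    where
    open +-*-Solver
    lemma : ∀ q p → q + (p - q) ≡ p
    lemma = solve 2 (λ q p → q :+ (p :- q) := p) refl

  <⇒distance : ∀ p q {ε} → p < q + ε → q < p + ε → ∣ p - q ∣ < ε
  <⇒distance p q {ε} p<q+ε q<p+ε with ∣p∣≡p∨∣p∣≡-p (p - q)
  ... | inj₁ e = subst₂ _<_ (sym e) (lemma q ε) (+-monoˡ-< (- q) p<q+ε)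
    where
    open +-*-Solver
    lemma : ∀ q ε → (q + ε) - q ≡ ε
    lemma = solve 2 (λ q ε → (q :+ ε) :- q := ε) refl
  ... | inj₂ e = subst₂ _<_ (trans (lemma₁ p q) (sym e)) (lemma₂ p ε) (+-monoˡ-< (- p) q<p+ε)
    where
    open +-*-Solver
    lemma₁ : ∀ p q → q - p ≡ - (p - q)
    lemma₁ = solve 2 (λ p q → q :- p := :- (p :- q)) refl
    lemma₂ : ∀ p ε → (p + ε) - p ≡ ε
    lemma₂ = solve 2 (λ p ε → (p :+ ε) :- p := ε) refl

  ⊔-< : ∀ {p q r} → p < r → q < r → p ⊔ q < r
  ⊔-< {p} {q} p<r q<r with ≤-total p q
  ... | inj₁ p≤q = subst (_< _) (sym (p≤q⇒p⊔q≡q p≤q)) q<r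
  ... | inj₂ q≤p = subst (_< _) (sym (p≥q⇒p⊔q≡p q≤p)) p<r

  ⊔-<-+ : ∀ {p q} r s ε → p < r + ε → q < s + ε → p ⊔ q < (r ⊔ s) + ε
  ⊔-<-+ r s ε p< q< =
    ⊔-< (<-≤-trans p< (+-monoˡ-≤ ε (p≤p⊔q r s)))
        (<-≤-trans q< (+-monoˡ-≤ ε (p≤q⊔p r s)))

  ≤-⊔ˡ : ∀ {a b n} → a ℕ.⊔ b ℕ.≤ n → a ℕ.≤ n
  ≤-⊔ˡ {a} {b} = ℕ.≤-trans (ℕ.m≤m⊔n a b)

  ≤-⊔ʳ : ∀ {a b n} → a ℕ.⊔ b ℕ.≤ n → b ℕ.≤ n
  ≤-⊔ʳ {a} {b} = ℕ.≤-trans (ℕ.m≤n⊔m a b)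

  const-cauchy : ∀ q → IsCauchy (λ _ → q)
  const-cauchy q ε 0<ε = 0 , λ _ _ _ _ → subst (_< ε) (sym (∣p-p∣≡0 q)) 0<ε

  +-cauchy : ∀ x y → IsCauchy x → IsCauchy y → IsCauchy (λ n → x n + y n)
  +-cauchy x y cx cy ε 0<ε with cx (ε * ½) (half-pos 0<ε) | cy (ε * ½) (half-pos 0<ε)
  ... | M , hx | N , hy = M ℕ.⊔ N , λ m n m≥ n≥ →
      subst₂ _<_ (cong ∣_∣ (lemma (x m) (x n) (y m) (y n))) (halves ε)
        (≤-<-trans (∣p+q∣≤∣p∣+∣q∣ (x m - x n) (y m - y n))
          (+-mono-< (hx m n (≤-⊔ˡ m≥) (≤-⊔ˡ n≥)) (hy m n (≤-⊔ʳ m≥) (≤-⊔ʳ n≥))))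
    where
    open +-*-Solver
    lemma : ∀ a b c d → (a - b) + (c - d) ≡ (a + c) - (b + d)
    lemma = solve 4 (λ a b c d → (a :- b) :+ (c :- d) := (a :+ c) :- (b :+ d)) refl

  ⊔-cauchy : ∀ x y → IsCauchy x → IsCauchy y → IsCauchy (λ n → x n ⊔ y n)
  ⊔-cauchy x y cx cy ε 0<ε with cx ε 0<ε | cy ε 0<ε
  ... | M , hx | N , hy = M ℕ.⊔ N , λ m n m≥ n≥ →
    <⇒distance (x m ⊔ y m) (x n ⊔ y n)
      (⊔-<-+ (x n) (y n) ε (distance⇒< (x m) (x n) (hx m n (≤-⊔ˡ m≥) (≤-⊔ˡ n≥))) (distance⇒< (y m) (y n) (hy m n (≤-⊔ʳ m≥) (≤-⊔ʳ n≥))))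
      (⊔-<-+ (x m) (y m) ε (distance⇒< (x n) (x m) (hx n m (≤-⊔ˡ n≥) (≤-⊔ˡ m≥))) (distance⇒< (y n) (y m) (hy n m (≤-⊔ʳ n≥) (≤-⊔ʳ m≥))))

  bounded : ∀ x → IsCauchy x →
    ∃ λ B → 0ℚ < B × ∃ λ N → ∀ n → N ℕ.≤ n → ∣ x n ∣ ≤ B
  bounded x cx with cx 1ℚ (positive⁻¹ 1ℚ)
  ... | N , h = ∣ x N ∣ + 1ℚ , +-mono-≤-< (0≤∣p∣ (x N)) (positive⁻¹ 1ℚ) , N , λ n n≥ →
      ≤-trans (≤-reflexive (cong ∣_∣ (lemma (x N) (x n))))
        (≤-trans (∣p+q∣≤∣p∣+∣q∣ (x N) (x n - x N))
          (+-monoʳ-≤ ∣ x N ∣ (<⇒≤ (h n N n≥ ℕ.≤-refl))))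
    where
    open +-*-Solver
    lemma : ∀ a b → b ≡ a + (b - a)
    lemma = solve 2 (λ a b → b := a :+ (b :- a)) refl

  divide : ∀ B → 0ℚ < B → ∀ ε → 0ℚ < ε → ∃ λ δ → 0ℚ < δ × B * δ ≡ ε
  divide B 0<B ε 0<ε = 1/ B * ε , pos*pos (positive⁻¹ (1/ B) {{1/pos⇒pos B}}) 0<ε ,
      trans (sym (*-assoc B (1/ B) ε)) (trans (cong (_* ε) (*-inverseʳ B)) (*-identityˡ ε))
    where
    instance
      B-pos : Positive B
      B-pos = positive 0<B
      B-nonZero : NonZero B
      B-nonZero = pos⇒nonZero B

  ∣*∣-< : ∀ p q {B δ} → 0ℚ < B → ∣ p ∣ ≤ B → ∣ q ∣ < δ → ∣ p * q ∣ < B * δ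
  ∣*∣-< p q {B} 0<B p≤ q< = subst (_< _) (sym (∣p*q∣≡∣p∣*∣q∣ p q))
    (≤-<-trans (*-monoʳ-≤-nonNeg ∣ q ∣ {{∣-∣-nonNeg q}} p≤) (*-monoʳ-<-pos B {{positive 0<B}} q<))

  *-cauchy : ∀ x y → IsCauchy x → IsCauchy y → IsCauchy (λ n → x n * y n)
  *-cauchy x y cx cy ε 0<ε =
    let A , 0<A , N₁ , hA = bounded x cx
        B , 0<B , N₂ , hB = bounded y cy
        α , 0<α , eα = divide A 0<A (ε * ½) (half-pos 0<ε)
        β , 0<β , eβ = divide B 0<B (ε * ½) (half-pos 0<ε)
        N₃ , hy = cy α 0<α
        N₄ , hx = cx β 0<β
    in (N₁ ℕ.⊔ N₂) ℕ.⊔ (N₃ ℕ.⊔ N₄) , λ m n m≥ n≥ →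
      subst₂ _<_ (cong ∣_∣ (lemma (x m) (x n) (y m) (y n)))
        (trans (cong₂ _+_ eα eβ) (halves ε))
        (≤-<-trans (∣p+q∣≤∣p∣+∣q∣ (x m * (y m - y n)) (y n * (x m - x n)))
          (+-mono-<
            (∣*∣-< (x m) (y m - y n) 0<A (hA m (≤-⊔ˡ (≤-⊔ˡ m≥)))
              (hy m n (≤-⊔ˡ {N₃} (≤-⊔ʳ {N₁ ℕ.⊔ N₂} m≥)) (≤-⊔ˡ {N₃} (≤-⊔ʳ {N₁ ℕ.⊔ N₂} n≥))))
            (∣*∣-< (y n) (x m - x n) 0<B (hB n (≤-⊔ʳ {N₁} (≤-⊔ˡ n≥)))
              (hx m n (≤-⊔ʳ {N₃} (≤-⊔ʳ {N₁ ℕ.⊔ N₂} m≥)) (≤-⊔ʳ {N₃} (≤-⊔ʳ {N₁ ℕ.⊔ N₂} n≥))))))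
    where
    open +-*-Solver
    lemma : ∀ a b c d → a * (c - d) + d * (a - b) ≡ a * c - b * d
    lemma = solve 4 (λ a b c d → a :* (c :- d) :+ d :* (a :- b) := a :* c :- b :* d) refl

  pos-max : ∀ q {ε} → 0ℚ < ε → Positive (q ⊔ ε)
  pos-max q {ε} 0<ε = positive (<-≤-trans 0<ε (p≤q⊔p q ε))

open CauchyLemmas

recipMax : ∀ {ε} → 0ℚ < ε → ℚ → ℚ
recipMax {ε} 0<ε q = 1/_ (q ⊔ ε) {{pos⇒nonZero (q ⊔ ε) {{pos-max q 0<ε}}}}

module RecipLemmas where
  recipMax-inverse : ∀ {ε} (0<ε : 0ℚ < ε) q → (q ⊔ ε) * recipMax 0<ε q ≡ 1ℚ
  recipMax-inverse {ε} 0<ε q = *-inverseʳ (q ⊔ ε) {{pos⇒nonZero (q ⊔ ε) {{pos-max q 0<ε}}}}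

  recipMax-pos : ∀ {ε} (0<ε : 0ℚ < ε) q → Positive (recipMax 0<ε q)
  recipMax-pos {ε} 0<ε q = 1/pos⇒pos (q ⊔ ε) {{pos-max q 0<ε}}

  recipMax-bound : ∀ {ε} (0<ε : 0ℚ < ε) q → ε * ∣ recipMax 0<ε q ∣ ≤ 1ℚ
  recipMax-bound {ε} 0<ε q = subst (λ r → ε * r ≤ 1ℚ)
      (sym (0≤p⇒∣p∣≡p (<⇒≤ (positive⁻¹ r {{recipMax-pos 0<ε q}}))))
      (subst (ε * r ≤_) (recipMax-inverse 0<ε q)
        (*-monoʳ-≤-nonNeg r {{pos⇒nonNeg r {{recipMax-pos 0<ε q}}}} (p≤q⊔p q ε)))
    where r = recipMax 0<ε q

  recip-cauchy : ∀ x {ε} (0<ε : 0ℚ < ε) → IsCauchy x → IsCauchy (λ n → recipMax 0<ε (x n))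
  recip-cauchy x {ε} 0<ε cx η 0<η =
    let N , h = ⊔-cauchy x (λ _ → ε) cx (const-cauchy ε) (ε * ε * η) (pos*pos (pos*pos 0<ε 0<ε) 0<η)
    in N , λ m n m≥ n≥ → close m n (h n m n≥ m≥)
    where
    open +-*-Solver
    instance
      εε-nonNeg : NonNegative (ε * ε)
      εε-nonNeg = nonNegative (<⇒≤ (pos*pos 0<ε 0<ε))
    diff : ∀ a b r s → a * r ≡ 1ℚ → b * s ≡ 1ℚ → r - s ≡ (b - a) * (r * s)
    diff a b r s ar bs = trans
      (sym (trans (cong₂ (λ u v → u * r - v * s) bs ar)
        (cong₂ _-_ (*-identityˡ r) (*-identityˡ s))))
      (solve 4 (λ a b r s → (b :* s) :* r :- (a :* r) :* s := (b :- a) :* (r :* s)) refl a b r s)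
    regroup : ∀ e d r s → e * e * (d * (r * s)) ≡ d * ((e * r) * (e * s))
    regroup = solve 4 (λ e d r s → e :* e :* (d :* (r :* s)) := d :* ((e :* r) :* (e :* s))) refl
    close : ∀ m n → ∣ (x n ⊔ ε) - (x m ⊔ ε) ∣ < ε * ε * η →
            ∣ recipMax 0<ε (x m) - recipMax 0<ε (x n) ∣ < η
    close m n d< = *-cancelˡ-<-nonNeg (ε * ε) (≤-<-trans bound d<)
      where
      r = recipMax 0<ε (x m)
      s = recipMax 0<ε (x n)
      a = x m ⊔ ε
      b = x n ⊔ ε
      product≤1 : (ε * ∣ r ∣) * (ε * ∣ s ∣) ≤ 1ℚ
      product≤1 = ≤-trans
        (*-monoʳ-≤-nonNeg (ε * ∣ s ∣)
          {{nonNeg*nonNeg⇒nonNeg ε {{nonNegative (<⇒≤ 0<ε)}} ∣ s ∣ {{∣-∣-nonNeg s}}}}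
          (recipMax-bound 0<ε (x m)))
        (subst (_≤ 1ℚ) (sym (*-identityˡ (ε * ∣ s ∣))) (recipMax-bound 0<ε (x n)))
      abs : ∣ r - s ∣ ≡ ∣ b - a ∣ * (∣ r ∣ * ∣ s ∣)
      abs = trans (cong ∣_∣ (diff a b r s (recipMax-inverse 0<ε (x m)) (recipMax-inverse 0<ε (x n))))
        (trans (∣p*q∣≡∣p∣*∣q∣ (b - a) (r * s)) (cong (∣ b - a ∣ *_) (∣p*q∣≡∣p∣*∣q∣ r s)))
      bound : ε * ε * ∣ r - s ∣ ≤ ∣ b - a ∣
      bound = ≤-trans
        (≤-reflexive (trans (cong (ε * ε *_) abs) (regroup ε (∣ b - a ∣) (∣ r ∣) (∣ s ∣))))
        (subst (∣ b - a ∣ * ((ε * ∣ r ∣) * (ε * ∣ s ∣)) ≤_) (*-identityʳ ∣ b - a ∣)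
          (*-monoˡ-≤-nonNeg ∣ b - a ∣ {{∣-∣-nonNeg (b - a)}} product≤1))

open RecipLemmas

fromℚ : ℚ → ℝ
fromℚ q = mkℝ (λ _ → q) (const-cauchy q)

fromℕ : ℕ → ℝ
fromℕ k = fromℚ (+ k / 1)

0ᴿ 1ᴿ : ℝ
0ᴿ = fromℚ 0ℚ
1ᴿ = fromℚ 1ℚ

_+ᴿ_ _*ᴿ_ _⊔ᴿ_ : ℝ → ℝ → ℝ
x +ᴿ y = mkℝ (λ n → seq x n + seq y n) (+-cauchy (seq x) (seq y) (cauchy x) (cauchy y))
x *ᴿ y = mkℝ (λ n → seq x n * seq y n) (*-cauchy (seq x) (seq y) (cauchy x) (cauchy y))
x ⊔ᴿ y = mkℝ (λ n → seq x n ⊔ seq y n) (⊔-cauchy (seq x) (seq y) (cauchy x) (cauchy y))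

-- The witness of 0ᴿ <ᴿ y provides ε > 0 with ε ≤ seq y n for all large n, so
-- truncating the sequence below at ε changes only finitely many terms.
recip : (y : ℝ) → 0ᴿ <ᴿ y → ℝ
recip y (_ , 0<ε , _) = mkℝ (λ n → recipMax 0<ε (seq y n)) (recip-cauchy (seq y) 0<ε (cauchy y))

_/ᴿ_[_] : ℝ → (y : ℝ) → 0ᴿ <ᴿ y → ℝ
x /ᴿ y [ y>0 ] = x *ᴿ recip y y>0

+ᴿ-rawMonoid : RawMonoid 0ℓ 0ℓ
+ᴿ-rawMonoid = record { Carrier = ℝ ; _≈_ = _≈ᴿ_ ; _∙_ = _+ᴿ_ ; ε = 0ᴿ }

open RawMonoidDefinitions +ᴿ-rawMonoid public using (sum)

0<1ᴿ : 0ᴿ <ᴿ 1ᴿ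
0<1ᴿ = 1ℚ , positive⁻¹ 1ℚ , 0 , λ _ _ → ≤-refl

-- Edges are undirected; weight-sym makes the weight a function of the
-- unordered pair, independent also of the proof of adjacency.
record WeightedGraph (n : ℕ) : Set₁ where
  field
    Edge       : Fin n → Fin n → Set
    edge?      : ∀ x y → Dec (Edge x y)
    symmetric  : ∀ {x y} → Edge x y → Edge y x
    loopless   : ∀ {x y} → Edge x y → x ≢ y
    weight     : ∀ {x y} → Edge x y → ℝ
    weight-sym : ∀ {x y} (e : Edge x y) (e′ : Edge y x) → weight e ≈ᴿ weight e′
    weight-pos : ∀ {x y} (e : Edge x y) → 0ᴿ <ᴿ weight e

complete : ∀ n → WeightedGraph n
complete n = record
  { Edge       = _≢_
  ; edge?      = λ x y → ¬? (x Fin.≟ y)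
  ; symmetric  = ≢-sym
  ; loopless   = λ x≢y → x≢y
  ; weight     = λ _ → 1ᴿ
  ; weight-sym = λ _ _ ε 0<ε → 0 , λ _ _ → subst (_< ε) (sym (∣p-p∣≡0 1ℚ)) 0<ε
  ; weight-pos = λ _ → 0<1ᴿ
  }

module _ {n : ℕ} (G : WeightedGraph n) where
  open WeightedGraph G

  data Walk : Fin n → Fin n → ℕ → Set where
    here : ∀ {x} → Walk x x 0
    step : ∀ {x y z k} → Edge x y → Walk y z k → Walk x z (suc k)

  Connected : Set
  Connected = ∀ x y → ∃ (Walk x y)

  IsDistance : Fin n → Fin n → ℕ → Set
  IsDistance x y k = Walk x y k × (∀ j → Walk x y j → k ℕ.≤ j)

  weightWhen : ∀ {x y} → Dec (x <ᶠ y × Edge x y) → ℝ → ℝ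
  weightWhen (yes (_ , e)) r = weight e *ᴿ r
  weightWhen (no  _)       r = 0ᴿ

  -- The sum of w_xy f(x,y) over E: the condition x < y selects one
  -- orientation of every edge.
  edgeSum : (Fin n → Fin n → ℝ) → ℝ
  edgeSum f = sum λ x → sum λ y →
    weightWhen ((x Fin.<? y) ×-dec edge? x y) (f x y)

data Tree (n : ℕ) : Set where
  leaf : Fin n → Tree n
  node : Tree n → Tree n → Tree n

leaves : ∀ {n} → Tree n → List (Fin n)
leaves (leaf x)   = x ∷ []
leaves (node l r) = leaves l ++ leaves r

IsHierarchy : ∀ {n} → Tree n → Set
IsHierarchy {n} T = leaves T ↭ allFin n

module _ {n : ℕ} where
  open import Data.List.Membership.DecPropositional (Fin._≟_ {n}) using (_∈_; _∈?_)

  both∈? : ∀ x y (T : Tree n) → Dec (x ∈ leaves T × y ∈ leaves T)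
  both∈? x y T = (x ∈? leaves T) ×-dec (y ∈? leaves T)

  -- The cluster of the lowest common ancestor, found by descending from the
  -- root while one child still contains both vertices.
  cluster : Tree n → Fin n → Fin n → List (Fin n)
  cluster (leaf z)   x y = z ∷ []
  cluster (node l r) x y =
    if does (both∈? x y l) then cluster l x y else
    if does (both∈? x y r) then cluster r x y else
    leaves (node l r)

module _ {n : ℕ} where
  open import Function.Metric.Structures (_≡_ {A = Fin n}) _≈ᴿ_ _≤ᴿ_ 0ᴿ using (IsGeneralMetric)

  IsUltrametric : (Fin n → Fin n → ℝ) → Set
  IsUltrametric u =
    IsGeneralMetric _+ᴿ_ u × (∀ x y z → u x y ≤ᴿ u x z ⊔ᴿ u z y)

IsMinimum : {A : Set} → (A → Set) → (A → ℝ) → ℝ → Set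
IsMinimum P f m = (∃ λ a → P a × f a ≈ᴿ m) × (∀ a → P a → m ≤ᴿ f a)

module _ {n : ℕ} (G : WeightedGraph n) where

  DominatesDistance : (Fin n → Fin n → ℝ) → Set
  DominatesDistance u = ∀ x y k → IsDistance G x y k → fromℕ k ≤ᴿ u x y

  IsOPT-D : ℝ → Set
  IsOPT-D = IsMinimum IsHierarchy
    (λ T → edgeSum G (λ x y → fromℕ (length (cluster T x y))))

  IsOPT-free : ℝ → Set
  IsOPT-free = IsMinimum (λ u → IsUltrametric u × DominatesDistance u) (edgeSum G)

  IsRatio : ℝ → Set
  IsRatio ρ = ∃₂ λ D F → IsOPT-D D × IsOPT-free F ×
    Σ (0ᴿ <ᴿ F) λ F>0 → D /ᴿ F [ F>0 ] ≈ᴿ ρ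

factor : ℕ → ℝ
factor n = fromℚ (+ (2 ℕ.* (n ℕ.+ 1)) / 3)

-- Over all n! caterpillar hierarchies, the cluster of the lowest common ancestor of
-- two fixed vertices has average size 2(n+1)/3: the first removed vertex is one of
-- the two with probability 2/n (then the size is n), and otherwise one recurses on
-- n - 1 vertices.  Hence OPT_D is at most 2(n+1)/3 times the total weight W, while
-- OPT_free ≥ W since adjacent vertices are at distance 1.  On K_n every hierarchy has
-- the same cost and the discrete metric attains W, so both bounds are equalities.
-- The optima exist because only finitely many candidates matter: hierarchies enter
-- through their cluster sizes, and an ultrametric may be rounded down to integers.

module Submission where

open import Defs
open import Algebra.Bundles using (CommutativeRing)
open import Data.Bool.Base using (if_then_else_; true; false)
open import Data.Bool.Properties using (∧-comm)
open import Data.Fin.Base as Fin using (Fin; zero; suc; punchIn; punchOut)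
import Data.Fin.Properties as Fin
import Data.Integer.Base as ℤ
import Data.Integer.Properties as ℤ
open import Data.List.Base using (List; []; _∷_; _++_; length; tabulate; map; allFin)
import Data.List.Properties as List
open import Data.List.Membership.Propositional using (_∈_; _∉_)
open import Data.List.Membership.Propositional.Properties using (∈-tabulate⁺; ∈-tabulate⁻; ∈-++⁻)
open import Data.List.Relation.Binary.Disjoint.Propositional using (Disjoint)
open import Data.List.Relation.Binary.Permutation.Propositional
  using (_↭_; ↭-refl; ↭-reflexive; ↭-sym; ↭-trans; prep; swap; ↭⇒↭ₛ)
open import Data.List.Relation.Binary.Permutation.Propositional.Properties as ↭ using (∈-resp-↭; ↭-length)
import Data.List.Relation.Binary.Permutation.Setoid.Properties as ↭ₛ
import Data.List.Relation.Unary.All as All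
import Data.List.Relation.Unary.All.Properties as All
open import Data.List.Relation.Unary.AllPairs using ([]; _∷_)
open import Data.List.Relation.Unary.Any using (here; there)
open import Data.List.Relation.Unary.Unique.Propositional using (Unique)
import Data.List.Relation.Unary.Unique.Propositional.Properties as Unique
open import Data.Nat.Base as ℕ using (ℕ; _≤_; zero; suc)
open import Data.Nat.Induction using (<-rec)
import Data.Nat.ListAction as ℕ
open import Data.Nat.ListAction.Properties using (sum-↭; sum-++)
import Data.Nat.Properties as ℕ
import Data.Nat.Solver as ℕ-Solver
open import Data.Product.Base using (∃; _×_; _,_; proj₁; proj₂)
open import Data.Rational.Base as ℚ
  using (ℚ; 0ℚ; 1ℚ; ½; _+_; _*_; _-_; _<_; _⊔_; ∣_∣; positive; nonNegative; _/_)
import Data.Rational.Properties as ℚ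
open import Data.Rational.Solver using (module +-*-Solver)
import Data.Rational.Unnormalised.Base as ℚᵘ
import Data.Rational.Unnormalised.Properties as ℚᵘ
open import Data.Sum.Base using (_⊎_; inj₁; inj₂; [_,_]′)
open import Function.Base using (_∘_; id)
open import Function.Definitions using (Injective)
open import Function.Metric.Structures using (module IsGeneralMetric)
open import Relation.Binary.Definitions using (Tri; tri<; tri≈; tri>)
open import Relation.Binary.PropositionalEquality
open import Relation.Binary.Structures using (IsPartialOrder)
open import Relation.Nullary.Decidable
  using (Dec; yes; no; does; dec-true; dec-false; _×-dec_; ¬¬-excluded-middle; decidable-stable)
open import Relation.Nullary.Negation.Core using (¬_; contradiction)
open import Algebra.Properties.Semiring.Sum (CommutativeRing.semiring ℚ.+-*-commutativeRing)
  using (sum-cong-≗; ∑-distrib-+; ∑-comm; *-distribˡ-sum; *-distribʳ-sum) renaming (sum to ∑)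

open CauchyLemmas
open RecipLemmas

-- The order of Cauchy reals is undecidable, so even a minimum of finitely many reals cannot be
-- located constructively; this is why the existence of the ratio is asserted under a double
-- negation. Inequalities lose nothing by this, since `≤ᴿ` is equivalent to the negation of the
-- reversed strict order and hence stable. The averaging argument stays clear of real arithmetic: at
-- a fixed index k of the representing sequences every cost is a finite rational sum, so the sums
-- over caterpillars and over edges can be interchanged exactly, and the finitely many thresholds
-- involved merge into one. Averages are kept multiplied by 3 and by the number of caterpillars,
-- which leaves only identities without division. On the complete graph the cost of a hierarchy
-- depends on the number of leaves alone because 2a^3 + 2b^3 + 6ab(a + b) = 2(a + b)^3.

private
  variable
    m n : ℕ
    A : Set

-- Order properties of the Cauchy reals

Eventually : (ℕ → Set) → Set
Eventually P = ∃ λ N → ∀ k → N ≤ k → P k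

always : ∀ {P : ℕ → Set} → (∀ k → P k) → Eventually P
always p = 0 , λ k _ → p k

eventually-map : ∀ {P Q : ℕ → Set} → (∀ {k} → P k → Q k) → Eventually P → Eventually Q
eventually-map f (N , p) = N , λ k N≤k → f (p k N≤k)

eventually-zip : ∀ {P Q R : ℕ → Set} → (∀ {k} → P k → Q k → R k) → Eventually P → Eventually Q → Eventually R
eventually-zip f (M , p) (N , q) =
  M ℕ.⊔ N , λ k N≤k → f (p k (≤-⊔ˡ N≤k)) (q k (≤-⊔ʳ N≤k))

-- Finitely many thresholds have a maximum; this is what allows finite families of reals to be
-- compared at one common index.
eventually-∀ : {P : Fin n → ℕ → Set} → (∀ i → Eventually (P i)) →
  Eventually λ k → ∀ i → P i k
eventually-∀ {zero}  _ = always λ _ ()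
eventually-∀ {suc n} p =
  eventually-zip (λ p₀ p₊ → λ { zero → p₀ ; (suc i) → p₊ i }) (p zero) (eventually-∀ (p ∘ suc))

eventually-witness : ∀ {P : ℕ → Set} → Eventually P → ∃ P
eventually-witness (N , p) = N , p N ℕ.≤-refl

≤ᴿ-refl : ∀ {x} → x ≤ᴿ x
≤ᴿ-refl {x} ε 0<ε = always λ k →
  subst (_< seq x k + ε) (ℚ.+-identityʳ (seq x k)) (ℚ.+-monoʳ-< (seq x k) 0<ε)

≤ᴿ-trans : ∀ {x y z} → x ≤ᴿ y → y ≤ᴿ z → x ≤ᴿ z
≤ᴿ-trans {x} {y} {z} x≤y y≤z ε 0<ε =
  eventually-zip
    (λ {k} p q → ℚ.<-trans p (subst (seq y k + ε * ½ <_)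
      (trans (ℚ.+-assoc (seq z k) (ε * ½) (ε * ½)) (cong (seq z k +_) (halves ε)))
      (ℚ.+-monoˡ-< (ε * ½) q)))
    (x≤y (ε * ½) (half-pos 0<ε)) (y≤z (ε * ½) (half-pos 0<ε))

≈ᴿ⇒≤ᴿ : ∀ {x y} → x ≈ᴿ y → x ≤ᴿ y
≈ᴿ⇒≤ᴿ {x} {y} x≈y ε 0<ε = eventually-map (λ {k} → distance⇒< (seq x k) (seq y k)) (x≈y ε 0<ε)

≤ᴿ-antisym : ∀ {x y} → x ≤ᴿ y → y ≤ᴿ x → x ≈ᴿ y
≤ᴿ-antisym {x} {y} x≤y y≤x ε 0<ε =
  eventually-zip (λ {k} → <⇒distance (seq x k) (seq y k)) (x≤y ε 0<ε) (y≤x ε 0<ε)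

≡⇒≈ᴿ : ∀ {x y} → Eventually (λ k → seq x k ≡ seq y k) → x ≈ᴿ y
≡⇒≈ᴿ {x} {y} x≡y ε 0<ε = eventually-map
  (λ {k} p → subst (_< ε) (sym (trans (cong (λ q → ∣ q - seq y k ∣) p) (∣p-p∣≡0 (seq y k)))) 0<ε) x≡y

≈ᴿ-refl : ∀ {x} → x ≈ᴿ x
≈ᴿ-refl {x} = ≡⇒≈ᴿ {x} {x} (always λ _ → refl)

≈ᴿ-sym : ∀ {x y} → x ≈ᴿ y → y ≈ᴿ x
≈ᴿ-sym {x} {y} x≈y ε 0<ε =
  eventually-map (λ {k} → subst (_< ε) (∣p-q∣≡∣q-p∣ (seq x k) (seq y k))) (x≈y ε 0<ε)

≈ᴿ-trans : ∀ {x y z} → x ≈ᴿ y → y ≈ᴿ z → x ≈ᴿ z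
≈ᴿ-trans {x} {y} {z} x≈y y≈z =
  ≤ᴿ-antisym {x} {z}
    (≤ᴿ-trans {x} {y} {z} (≈ᴿ⇒≤ᴿ {x} {y} x≈y) (≈ᴿ⇒≤ᴿ {y} {z} y≈z))
    (≤ᴿ-trans {z} {y} {x} (≈ᴿ⇒≤ᴿ {z} {y} (≈ᴿ-sym {y} {z} y≈z)) (≈ᴿ⇒≤ᴿ {y} {x} (≈ᴿ-sym {x} {y} x≈y)))

≤ᴿ-isPartialOrder : IsPartialOrder _≈ᴿ_ _≤ᴿ_
≤ᴿ-isPartialOrder = record
  { isPreorder = record
    { isEquivalence = record
      { refl  = λ {x} → ≈ᴿ-refl {x}
      ; sym   = λ {x} {y} → ≈ᴿ-sym {x} {y}
      ; trans = λ {x} {y} {z} → ≈ᴿ-trans {x} {y} {z}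
      }
    ; reflexive = λ {x} {y} → ≈ᴿ⇒≤ᴿ {x} {y}
    ; trans     = λ {x} {y} {z} → ≤ᴿ-trans {x} {y} {z}
    }
  ; antisym = λ {x} {y} → ≤ᴿ-antisym {x} {y}
  }

≤⇒≤ᴿ : ∀ {x y} → Eventually (λ k → seq x k ℚ.≤ seq y k) → x ≤ᴿ y
≤⇒≤ᴿ {x} {y} x≤y ε 0<ε = eventually-map
  (λ {k} p → ℚ.≤-<-trans p (subst (_< seq y k + ε) (ℚ.+-identityʳ (seq y k)) (ℚ.+-monoʳ-< (seq y k) 0<ε))) x≤y

+ᴿ-mono-≤ : ∀ {x y z w} → x ≤ᴿ y → z ≤ᴿ w → x +ᴿ z ≤ᴿ y +ᴿ w
+ᴿ-mono-≤ {x} {y} {z} {w} x≤y z≤w ε 0<ε =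
  eventually-zip
    (λ {k} p q → subst (seq x k + seq z k <_)
      (trans (rearrange (seq y k) (seq w k) (ε * ½)) (cong (seq y k + seq w k +_) (halves ε)))
      (ℚ.+-mono-< p q))
    (x≤y (ε * ½) (half-pos 0<ε)) (z≤w (ε * ½) (half-pos 0<ε))
  where
  open +-*-Solver
  rearrange : ∀ p q δ → (p + δ) + (q + δ) ≡ (p + q) + (δ + δ)
  rearrange = solve 3 (λ p q δ → (p :+ δ) :+ (q :+ δ) := (p :+ q) :+ (δ :+ δ)) refl

-- Multiplication by `a` magnifies the error, so the hypothesis is invoked with δ = ε / B for an
-- eventual bound B of `a`. The witness of positivity makes a tail of `a` positive, which keeps the
-- inequality strict.
*ᴿ-monoˡ-≤ : ∀ a {x y} → 0ᴿ <ᴿ a → x ≤ᴿ y → a *ᴿ x ≤ᴿ a *ᴿ y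
*ᴿ-monoˡ-≤ a {x} {y} (α , 0<α , a≥α) x≤y ε 0<ε =
  let B , 0<B , a≤B = bounded (seq a) (cauchy a)
      δ , 0<δ , Bδ≡ε = divide B 0<B ε 0<ε
  in eventually-zip
      (λ {k} (0<a , a≤B) p → ℚ.<-≤-trans
        (ℚ.*-monoʳ-<-pos (seq a k) {{positive 0<a}} p)
        (subst₂ ℚ._≤_ (sym (ℚ.*-distribˡ-+ (seq a k) (seq y k) δ)) (cong (seq a k * seq y k +_) Bδ≡ε)
          (ℚ.+-monoʳ-≤ (seq a k * seq y k)
            (ℚ.*-monoʳ-≤-nonNeg δ {{nonNegative (ℚ.<⇒≤ 0<δ)}} (ℚ.≤-trans (p≤∣p∣ (seq a k)) a≤B)))))
      (eventually-zip (λ {k} p q → ℚ.<-≤-trans 0<α (subst (ℚ._≤ seq a k) (ℚ.+-identityˡ α) p) , q) a≥α a≤B)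
      (x≤y δ 0<δ)

sum-mono-≤ᴿ : {f g : Fin n → ℝ} → (∀ i → f i ≤ᴿ g i) → sum f ≤ᴿ sum g
sum-mono-≤ᴿ {zero}          f≤g = ≤ᴿ-refl {0ᴿ}
sum-mono-≤ᴿ {suc n} {f} {g} f≤g = +ᴿ-mono-≤ {f zero} {g zero} {sum (f ∘ suc)} {sum (g ∘ suc)}
  (f≤g zero) (sum-mono-≤ᴿ {f = f ∘ suc} {g ∘ suc} (f≤g ∘ suc))

-- One half of the gap between x and y pays for the error in y ≤ z, and the other half remains as
-- the new gap.
<ᴿ-≤ᴿ-trans : ∀ {x y z} → x <ᴿ y → y ≤ᴿ z → x <ᴿ z
<ᴿ-≤ᴿ-trans {x} {y} {z} (ε , 0<ε , x<y) y≤z =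
  ε * ½ , half-pos 0<ε , eventually-zip
    (λ {k} p q → ℚ.<⇒≤ (cancel (seq x k) (seq z k) (ℚ.≤-<-trans p q))) x<y (y≤z (ε * ½) (half-pos 0<ε))
  where
  open +-*-Solver
  cancel : ∀ p q → p + ε < q + ε * ½ → p + ε * ½ < q
  cancel p q h = subst₂ _<_
    (trans (cong (λ t → (p + t) - ε * ½) (sym (halves ε)))
      (solve 2 (λ p δ → (p :+ (δ :+ δ)) :- δ := p :+ δ) refl p (ε * ½)))
    (solve 2 (λ q δ → (q :+ δ) :- δ := q) refl q (ε * ½))
    (ℚ.+-monoˡ-< (ℚ.- (ε * ½)) h)

≤ᴿ⇒≯ᴿ : ∀ {x y} → x ≤ᴿ y → ¬ y <ᴿ x
≤ᴿ⇒≯ᴿ {x} {y} x≤y y<x =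
  let ε , 0<ε , y<y = <ᴿ-≤ᴿ-trans {y} {x} {y} y<x x≤y
      k , p = eventually-witness y<y
  in ℚ.<-irrefl refl (ℚ.<-≤-trans (subst (_< seq y k + ε) (ℚ.+-identityʳ (seq y k)) (ℚ.+-monoʳ-< (seq y k) 0<ε)) p)

≮ᴿ⇒≥ᴿ : ∀ {x y} → ¬ y <ᴿ x → x ≤ᴿ y
≮ᴿ⇒≥ᴿ {x} {y} y≮x ε 0<ε =
  let M , cx = cauchy x γ 0<γ
      N , cy = cauchy y γ 0<γ
      M≤K = ℕ.m≤m⊔n M N
      N≤K = ℕ.m≤n⊔m M N
  in compare (M ℕ.⊔ N)
       (λ k K≤k → cx k (M ℕ.⊔ N) (≤-⊔ˡ K≤k) M≤K)
       (λ k K≤k → cy k (M ℕ.⊔ N) (≤-⊔ʳ {M} K≤k) N≤K)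
  where
  open +-*-Solver
  -- Past some K both sequences move by less than γ = ε/8; comparing x and y at K with
  -- margin h + q = 6γ leaves either x < y + 8γ or y + 4γ < x from there on.
  h = ε * ½
  q = h * ½
  γ = q * ½
  0<γ = half-pos (half-pos (half-pos 0<ε))
  collect : ∀ p → ((p + γ) + (h + q)) + γ ≡ p + ε
  collect p = trans
    (solve 4 (λ p γ h q → ((p :+ γ) :+ (h :+ q)) :+ γ := p :+ (h :+ (q :+ (γ :+ γ)))) refl p γ h q)
    (cong (p +_) (trans (cong (λ t → h + (q + t)) (halves q)) (trans (cong (h +_) (halves h)) (halves ε))))
  compare : ∀ K →
    (∀ k → K ≤ k → ∣ seq x k - seq x K ∣ < γ) →
    (∀ k → K ≤ k → ∣ seq y k - seq y K ∣ < γ) →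
    Eventually λ k → seq x k < seq y k + ε
  compare K cx cy with seq x K ℚ.<? seq y K + (h + q)
  ... | yes xK<yK = K , λ k K≤k →
        subst (seq x k <_) (collect (seq y k))
          (ℚ.<-trans (distance⇒< (seq x k) (seq x K) (cx k K≤k))
            (ℚ.+-monoˡ-< γ (ℚ.<-trans xK<yK
              (ℚ.+-monoˡ-< (h + q) (distance⇒< (seq y K) (seq y k)
                (subst (_< γ) (∣p-q∣≡∣q-p∣ (seq y k) (seq y K)) (cy k K≤k)))))))
  ... | no xK≮yK = contradiction
        (h , half-pos 0<ε , K , λ k K≤k → ℚ.<⇒≤ (cancel k K≤k)) y≮x
    where
    cancel : ∀ k → K ≤ k → seq y k + h < seq x k
    cancel k K≤k = ℚ.≰⇒> λ xk≤yk+h → xK≮yK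
      (ℚ.<-≤-trans (distance⇒< (seq x K) (seq x k)
          (subst (_< γ) (∣p-q∣≡∣q-p∣ (seq x k) (seq x K)) (cx k K≤k)))
        (ℚ.≤-trans (ℚ.+-monoˡ-≤ γ xk≤yk+h)
          (ℚ.≤-trans (ℚ.+-monoˡ-≤ γ (ℚ.+-monoˡ-≤ h (ℚ.<⇒≤ (distance⇒< (seq y k) (seq y K) (cy k K≤k)))))
            (ℚ.≤-reflexive (trans (regroup (seq y K)) (cong (λ t → seq y K + (h + t)) (halves q)))))))
      where
      regroup : ∀ p → p + γ + h + γ ≡ p + (h + (γ + γ))
      regroup p = solve 3 (λ p γ h → p :+ γ :+ h :+ γ := p :+ (h :+ (γ :+ γ))) refl p γ h

-- Allows an inequality to be derived from distances and floors that are available only under a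
-- double negation.
≤ᴿ-stable : ∀ {x y} → ¬ ¬ (x ≤ᴿ y) → x ≤ᴿ y
≤ᴿ-stable {x} {y} ¬¬x≤y = ≮ᴿ⇒≥ᴿ {x} {y} λ y<x → ¬¬x≤y λ x≤y → ≤ᴿ⇒≯ᴿ {x} {y} x≤y y<x

¬¬≤ᴿ⊎>ᴿ : ∀ x y → ¬ ¬ (x ≤ᴿ y ⊎ y <ᴿ x)
¬¬≤ᴿ⊎>ᴿ x y neither = neither (inj₁ (≮ᴿ⇒≥ᴿ {x} {y} (neither ∘ inj₂)))

⊔ᴿ-<ᴿ : ∀ {x y z} → x <ᴿ z → y <ᴿ z → x ⊔ᴿ y <ᴿ z
⊔ᴿ-<ᴿ {x} {y} {z} (δ , 0<δ , x<z) (ε , 0<ε , y<z) =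
  δ ℚ.⊓ ε , ⊓-pos , eventually-zip
    (λ {k} p q → subst (ℚ._≤ seq z k)
      (sym (ℚ.mono-≤-distrib-⊔ {λ q → q + δ ℚ.⊓ ε} (ℚ.+-monoˡ-≤ (δ ℚ.⊓ ε)) (seq x k) (seq y k)))
      (ℚ.⊔-lub (ℚ.≤-trans (ℚ.+-monoʳ-≤ (seq x k) (ℚ.p⊓q≤p δ ε)) p)
               (ℚ.≤-trans (ℚ.+-monoʳ-≤ (seq y k) (ℚ.p⊓q≤q δ ε)) q)))
    x<z y<z
  where
  ⊓-pos : 0ℚ < δ ℚ.⊓ ε
  ⊓-pos with ℚ.⊓-sel δ ε
  ... | inj₁ e = subst (0ℚ <_) (sym e) 0<δ
  ... | inj₂ e = subst (0ℚ <_) (sym e) 0<ε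

-- Rational sums and edge sums

-- Opaque, since unification would otherwise unfold the gcd computed by _/_.
opaque
  ι : ℕ → ℚ
  ι m = ℤ.+ m / 1

  ι-/ : ∀ m → ℤ.+ m / 1 ≡ ι m
  ι-/ m = refl

-- Reduction to lowest terms obscures the numerator; in the unnormalised rationals the laws of `ι`
-- become identities of integers.
toℚᵘ-/ : ∀ i n .{{_ : ℕ.NonZero n}} → ℚ.toℚᵘ (i / n) ℚᵘ.≃ i ℚᵘ./ n
toℚᵘ-/ i (suc n) = ℚ.toℚᵘ-fromℚᵘ (ℚᵘ.mkℚᵘ i n)

opaque
  unfolding ι

  ι-+ : ∀ m n → ι (m ℕ.+ n) ≡ ι m + ι n
  ι-+ m n = ℚ.toℚᵘ-injective (begin
    ℚ.toℚᵘ (ι (m ℕ.+ n))                ≈⟨ toℚᵘ-/ (ℤ.+ (m ℕ.+ n)) 1 ⟩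
    ℤ.+ (m ℕ.+ n) ℚᵘ./ 1                ≈⟨ ℚᵘ.*≡* (cong (ℤ._* ℤ.1ℤ) (trans (ℤ.pos-+ m n)
                                             (sym (cong₂ ℤ._+_ (ℤ.*-identityʳ (ℤ.+ m)) (ℤ.*-identityʳ (ℤ.+ n)))))) ⟩
    (ℤ.+ m ℚᵘ./ 1) ℚᵘ.+ (ℤ.+ n ℚᵘ./ 1)    ≈⟨ ℚᵘ.+-cong (toℚᵘ-/ (ℤ.+ m) 1) (toℚᵘ-/ (ℤ.+ n) 1) ⟨
    ℚ.toℚᵘ (ι m) ℚᵘ.+ ℚ.toℚᵘ (ι n)      ≈⟨ ℚ.toℚᵘ-homo-+ (ι m) (ι n) ⟨
    ℚ.toℚᵘ (ι m + ι n)                  ∎)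
    where open ℚᵘ.≃-Reasoning

  ι-* : ∀ m n → ι (m ℕ.* n) ≡ ι m * ι n
  ι-* m n = ℚ.toℚᵘ-injective (begin
    ℚ.toℚᵘ (ι (m ℕ.* n))                ≈⟨ toℚᵘ-/ (ℤ.+ (m ℕ.* n)) 1 ⟩
    ℤ.+ (m ℕ.* n) ℚᵘ./ 1                ≈⟨ ℚᵘ.*≡* (cong (ℤ._* ℤ.1ℤ) (ℤ.pos-* m n)) ⟩
    (ℤ.+ m ℚᵘ./ 1) ℚᵘ.* (ℤ.+ n ℚᵘ./ 1)    ≈⟨ ℚᵘ.*-cong (toℚᵘ-/ (ℤ.+ m) 1) (toℚᵘ-/ (ℤ.+ n) 1) ⟨
    ℚ.toℚᵘ (ι m) ℚᵘ.* ℚ.toℚᵘ (ι n)      ≈⟨ ℚ.toℚᵘ-homo-* (ι m) (ι n) ⟨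
    ℚ.toℚᵘ (ι m * ι n)                  ∎)
    where open ℚᵘ.≃-Reasoning

  ι-mono-≤ : ∀ {m n} → m ≤ n → ι m ℚ.≤ ι n
  ι-mono-≤ {m} {n} m≤n = ℚ.toℚᵘ-cancel-≤ (begin
    ℚ.toℚᵘ (ι m)    ≃⟨ toℚᵘ-/ (ℤ.+ m) 1 ⟩
    ℤ.+ m ℚᵘ./ 1    ≤⟨ ℚᵘ.*≤* (ℤ.*-monoʳ-≤-nonNeg ℤ.1ℤ (ℤ.+≤+ m≤n)) ⟩
    ℤ.+ n ℚᵘ./ 1    ≃⟨ toℚᵘ-/ (ℤ.+ n) 1 ⟨
    ℚ.toℚᵘ (ι n)    ∎)
    where open ℚᵘ.≤-Reasoning

  ι-0 : ι 0 ≡ 0ℚ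
  ι-0 = refl

  ι-1 : ι 1 ≡ 1ℚ
  ι-1 = refl

-- Transparent numerals, with whose values the ring solver can compute; the opaque `ι` hides them.
2ℚ 3ℚ 4ℚ : ℚ
2ℚ = ℤ.+ 2 / 1
3ℚ = ℤ.+ 3 / 1
4ℚ = ℤ.+ 4 / 1

ι-2 : ι 2 ≡ 2ℚ
ι-2 = sym (ι-/ 2)

ι-3 : ι 3 ≡ 3ℚ
ι-3 = sym (ι-/ 3)

0≤ι : ∀ m → 0ℚ ℚ.≤ ι m
0≤ι m = subst (ℚ._≤ ι m) ι-0 (ι-mono-≤ ℕ.z≤n)

0<ι : ∀ m → 0ℚ < ι (suc m)
0<ι m = ℚ.<-≤-trans (ℚ.positive⁻¹ 1ℚ) (subst (ℚ._≤ ι (suc m)) ι-1 (ι-mono-≤ (ℕ.s≤s ℕ.z≤n)))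

fromℕ-mono-≤ : ∀ {k l} → k ≤ l → fromℕ k ≤ᴿ fromℕ l
fromℕ-mono-≤ {k} {l} k≤l = ≤⇒≤ᴿ {fromℕ k} {fromℕ l} (always λ _ → subst₂ ℚ._≤_ (sym (ι-/ k)) (sym (ι-/ l)) (ι-mono-≤ k≤l))

∑-mono-≤ : {f g : Fin n → ℚ} → (∀ i → f i ℚ.≤ g i) → ∑ f ℚ.≤ ∑ g
∑-mono-≤ {zero}  f≤g = ℚ.≤-refl
∑-mono-≤ {suc n} {f} {g} f≤g = ℚ.+-mono-≤ (f≤g zero) (∑-mono-≤ {f = f ∘ suc} {g ∘ suc} (f≤g ∘ suc))

∑-mono-< : {f g : Fin (suc n) → ℚ} → (∀ i → f i < g i) → ∑ f < ∑ g
∑-mono-< {n} {f} {g} f<g = ℚ.+-mono-<-≤ (f<g zero) (∑-mono-≤ {f = f ∘ suc} {g ∘ suc} (ℚ.<⇒≤ ∘ f<g ∘ suc))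

∑-const : ∀ n q → ∑ {n} (λ _ → q) ≡ ι n * q
∑-const zero    q = sym (trans (cong (_* q) ι-0) (ℚ.*-zeroˡ q))
∑-const (suc n) q = begin
  q + ∑ {n} (λ _ → q)    ≡⟨ cong₂ _+_ (sym (trans (cong (_* q) ι-1) (ℚ.*-identityˡ q))) (∑-const n q) ⟩
  ι 1 * q + ι n * q      ≡⟨ ℚ.*-distribʳ-+ q (ι 1) (ι n) ⟨
  (ι 1 + ι n) * q        ≡⟨ cong (_* q) (ι-+ 1 n) ⟨
  ι (suc n) * q          ∎
  where open ≡-Reasoning

∑0 : ∀ n → ∑ {n} (λ _ → 0ℚ) ≡ 0ℚ
∑0 n = trans (∑-const n 0ℚ) (ℚ.*-zeroʳ (ι n))

∑-nonneg : {f : Fin n → ℚ} → (∀ i → 0ℚ ℚ.≤ f i) → 0ℚ ℚ.≤ ∑ f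
∑-nonneg {n} {f} 0≤f = subst (ℚ._≤ ∑ f) (∑0 n) (∑-mono-≤ {f = λ _ → 0ℚ} {f} 0≤f)

term≤∑ : {f : Fin n → ℚ} → (∀ i → 0ℚ ℚ.≤ f i) → ∀ i → f i ℚ.≤ ∑ f
term≤∑ {suc n} {f} 0≤f zero    = subst (ℚ._≤ f zero + ∑ (f ∘ suc)) (ℚ.+-identityʳ (f zero))
  (ℚ.+-monoʳ-≤ (f zero) (∑-nonneg {f = f ∘ suc} (0≤f ∘ suc)))
term≤∑ {suc n} {f} 0≤f (suc i) = subst (ℚ._≤ f zero + ∑ (f ∘ suc)) (ℚ.+-identityˡ (f (suc i)))
  (ℚ.+-mono-≤ (0≤f zero) (term≤∑ {f = f ∘ suc} (0≤f ∘ suc) i))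

seq-sum : ∀ (f : Fin n → ℝ) k → seq (sum f) k ≡ ∑ (λ i → seq (f i) k)
seq-sum {zero}  f k = refl
seq-sum {suc n} f k = cong (seq (f zero) k +_) (seq-sum (f ∘ suc) k)

module _ (G : WeightedGraph n) where
  open WeightedGraph G

  coefficientWhen : ∀ {x y} → Dec (x Fin.< y × Edge x y) → ℕ → ℚ
  coefficientWhen (yes (_ , e)) k = seq (weight e) k
  coefficientWhen (no _)        k = 0ℚ

  -- Vanishing off the selected orientation of the edges, these numbers turn an edge sum, at each
  -- index, into an unrestricted rational double sum, to which the laws of finite sums apply.
  coefficient : ℕ → Fin n → Fin n → ℚ
  coefficient k x y = coefficientWhen ((x Fin.<? y) ×-dec edge? x y) k

  seq-weightWhen : ∀ {x y} (d : Dec (x Fin.< y × Edge x y)) r k →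
    seq (weightWhen G d r) k ≡ coefficientWhen d k * seq r k
  seq-weightWhen (yes _) r k = refl
  seq-weightWhen (no _)  r k = sym (ℚ.*-zeroˡ (seq r k))

  seq-edgeSum : ∀ f k →
    seq (edgeSum G f) k ≡ ∑ λ x → ∑ λ y → coefficient k x y * seq (f x y) k
  seq-edgeSum f k = trans (seq-sum (λ x → sum (term x)) k)
    (sum-cong-≗ {x = λ x → seq (sum (term x)) k} {λ x → ∑ (term′ x)} λ x → trans (seq-sum (term x) k)
      (sum-cong-≗ {x = λ y → seq (term x y) k} {term′ x} λ y →
        seq-weightWhen ((x Fin.<? y) ×-dec edge? x y) (f x y) k))
    where
    term : Fin n → Fin n → ℝ
    term x y = weightWhen G ((x Fin.<? y) ×-dec edge? x y) (f x y)
    term′ : Fin n → Fin n → ℚ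
    term′ x y = coefficient k x y * seq (f x y) k

  coefficient-zero : ∀ k x → coefficient k x x ≡ 0ℚ
  coefficient-zero k x with (x Fin.<? x) ×-dec edge? x x
  ... | yes (x<x , _) = contradiction x<x (ℕ.<-irrefl refl)
  ... | no _          = refl

  -- Positivity of a real says nothing about the first terms of its sequence, hence the threshold.
  coefficients-nonneg : Eventually λ k → ∀ x y → 0ℚ ℚ.≤ coefficient k x y
  coefficients-nonneg = eventually-∀ λ x → eventually-∀ λ y → nonneg ((x Fin.<? y) ×-dec edge? x y)
    where
    nonneg : ∀ {x y} (d : Dec (x Fin.< y × Edge x y)) → Eventually λ k → 0ℚ ℚ.≤ coefficientWhen d k
    nonneg (yes (_ , e)) = let ε , 0<ε , p = weight-pos e in
      eventually-map (λ q → ℚ.≤-trans (ℚ.<⇒≤ 0<ε) (subst (ℚ._≤ _) (ℚ.+-identityˡ ε) q)) p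
    nonneg (no _)        = always λ _ → ℚ.≤-refl

  edgeSum-mono-≤ : ∀ {f g} → (∀ {x y} → Edge x y → f x y ≤ᴿ g x y) → edgeSum G f ≤ᴿ edgeSum G g
  edgeSum-mono-≤ {f} {g} f≤g =
    sum-mono-≤ᴿ {f = λ x → sum λ y → weightWhen G ((x Fin.<? y) ×-dec edge? x y) (f x y)}
                {g = λ x → sum λ y → weightWhen G ((x Fin.<? y) ×-dec edge? x y) (g x y)} λ x →
    sum-mono-≤ᴿ {f = λ y → weightWhen G ((x Fin.<? y) ×-dec edge? x y) (f x y)}
                {g = λ y → weightWhen G ((x Fin.<? y) ×-dec edge? x y) (g x y)} λ y →
    term ((x Fin.<? y) ×-dec edge? x y)
    where
    term : ∀ {x y} (d : Dec (x Fin.< y × Edge x y)) → weightWhen G d (f x y) ≤ᴿ weightWhen G d (g x y)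
    term {x} {y} (yes (_ , e)) = *ᴿ-monoˡ-≤ (weight e) {f x y} {g x y} (weight-pos e) (f≤g e)
    term         (no _)        = ≤ᴿ-refl {0ᴿ}

  totalWeight : ℝ
  totalWeight = edgeSum G λ _ _ → 1ᴿ

  coefficient≤totalWeight : ∀ k → (∀ i j → 0ℚ ℚ.≤ coefficient k i j) →
    ∀ x y → coefficient k x y ℚ.≤ seq totalWeight k
  coefficient≤totalWeight k nonneg x y = begin
    coefficient k x y         ≡⟨ ℚ.*-identityʳ (coefficient k x y) ⟨
    a x y                     ≤⟨ term≤∑ {f = a x} (a-nonneg x) y ⟩
    ∑ (a x)                   ≤⟨ term≤∑ {f = λ i → ∑ (a i)} (λ i → ∑-nonneg {f = a i} (a-nonneg i)) x ⟩
    (∑ λ i → ∑ (a i))         ≡⟨ seq-edgeSum (λ _ _ → 1ᴿ) k ⟨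
    seq totalWeight k         ∎
    where
    open ℚ.≤-Reasoning
    a : Fin n → Fin n → ℚ
    a i j = coefficient k i j * 1ℚ
    a-nonneg : ∀ i j → 0ℚ ℚ.≤ a i j
    a-nonneg i j = subst (0ℚ ℚ.≤_) (sym (ℚ.*-identityʳ (coefficient k i j))) (nonneg i j)

  -- The decision may carry a proof of adjacency other than the given one, so the weight that enters
  -- the sum belongs to some proof `e`, whose weight is positive all the same.
  coefficientWhen-positive : ∀ {x y} (d : Dec (x Fin.< y × Edge x y)) → x Fin.< y → Edge x y →
    ∃ λ e → ∀ k → coefficientWhen d k ≡ seq (weight {x} {y} e) k
  coefficientWhen-positive (yes (_ , e)) _   _ = e , λ _ → refl
  coefficientWhen-positive (no ¬d)       x<y e = contradiction (x<y , e) ¬d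

  ordered-pos : ∀ {x y} → x Fin.< y → Edge x y → 0ᴿ <ᴿ totalWeight
  ordered-pos {x} {y} x<y e =
    let e′ , eq = coefficientWhen-positive ((x Fin.<? y) ×-dec edge? x y) x<y e
    in <ᴿ-≤ᴿ-trans {0ᴿ} {weight e′} {totalWeight} (weight-pos e′)
         (≤⇒≤ᴿ {weight e′} {totalWeight} (eventually-map
           (λ {k} nonneg → subst (ℚ._≤ seq totalWeight k) (eq k) (coefficient≤totalWeight k nonneg x y))
           coefficients-nonneg))

  totalWeight-pos : ∀ {x y} → Edge x y → 0ᴿ <ᴿ totalWeight
  totalWeight-pos {x} {y} e = by-order (Fin.<-cmp x y)
    where
    by-order : Tri (x Fin.< y) (x ≡ y) (y Fin.< x) → 0ᴿ <ᴿ totalWeight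
    by-order (tri< x<y _ _) = ordered-pos x<y e
    by-order (tri≈ _ x≡y _) = contradiction x≡y (loopless e)
    by-order (tri> _ _ y<x) = ordered-pos y<x (symmetric e)

-- Averaging over caterpillars

cluster-left : ∀ (l r : Tree n) {x y} → x ∈ leaves l → y ∈ leaves l →
  cluster (node l r) x y ≡ cluster l x y
cluster-left l r {x} {y} x∈l y∈l rewrite dec-true (both∈? x y l) (x∈l , y∈l) = refl

cluster-right : ∀ (l r : Tree n) {x y} → ¬ (x ∈ leaves l × y ∈ leaves l) →
  x ∈ leaves r → y ∈ leaves r → cluster (node l r) x y ≡ cluster r x y
cluster-right l r {x} {y} ∉l x∈r y∈r
  rewrite dec-false (both∈? x y l) ∉l | dec-true (both∈? x y r) (x∈r , y∈r) = refl

cluster-root : ∀ (l r : Tree n) {x y} → ¬ (x ∈ leaves l × y ∈ leaves l) →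
  ¬ (x ∈ leaves r × y ∈ leaves r) → cluster (node l r) x y ≡ leaves (node l r)
cluster-root l r {x} {y} ∉l ∉r
  rewrite dec-false (both∈? x y l) ∉l | dec-false (both∈? x y r) ∉r = refl

size : Fin n → Fin n → Tree n → ℚ
size x y T = ι (length (cluster T x y))

tabulate-punchIn : {A : Set} (f : Fin (suc n) → A) → ∀ i → f i ∷ tabulate (f ∘ punchIn i) ↭ tabulate f
tabulate-punchIn         f zero    = ↭-refl
tabulate-punchIn {suc n} f (suc i) =
  ↭-trans (swap (f (suc i)) (f zero) ↭-refl) (prep (f zero) (tabulate-punchIn (f ∘ suc) i))

-- The sum of g over all caterpillars whose leaves, read from the root, are an
-- arrangement of the values of f; there are (suc m)! = count m of them.
total : (Fin (suc m) → Fin n) → (Tree n → ℚ) → ℚ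
total {zero}  f g = g (leaf (f zero))
total {suc m} f g = ∑ λ i → total (f ∘ punchIn i) (g ∘ node (leaf (f i)))

count : ℕ → ℚ
count zero    = 1ℚ
count (suc m) = ι (2 ℕ.+ m) * count m

count-pos : ∀ m → 0ℚ < count m
count-pos zero    = ℚ.positive⁻¹ 1ℚ
count-pos (suc m) = pos*pos (0<ι (suc m)) (count-pos m)

-- The restriction to trees whose leaves arrange the values of `f` matters: the cluster sizes
-- computed below are correct only for those.
total-cong : ∀ (f : Fin (suc m) → Fin n) {g h} →
  (∀ T → leaves T ↭ tabulate f → g T ≡ h T) → total f g ≡ total f h
total-cong {zero}  f         g≡h = g≡h (leaf (f zero)) ↭-refl
total-cong {suc m} f {g} {h} g≡h =
  sum-cong-≗ {x = λ i → total (f ∘ punchIn i) (g ∘ node (leaf (f i)))}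
             {λ i → total (f ∘ punchIn i) (h ∘ node (leaf (f i)))} λ i →
  total-cong (f ∘ punchIn i) λ T T↭ →
    g≡h (node (leaf (f i)) T) (↭-trans (prep (f i) T↭) (tabulate-punchIn f i))

-- There are finitely many caterpillars, so one threshold serves them all, and at least one, so the
-- strict inequality survives summation.
total-eventually-< : ∀ (f : Fin (suc m) → Fin n) {g h : ℕ → Tree n → ℚ} →
  (∀ T → leaves T ↭ tabulate f → Eventually λ k → g k T < h k T) →
  Eventually λ k → total f (g k) < total f (h k)
total-eventually-< {zero}  f         g<h = g<h (leaf (f zero)) ↭-refl
total-eventually-< {suc m} f {g} {h} g<h =
  eventually-map
    (λ {k} → ∑-mono-< {f = λ i → total (f ∘ punchIn i) (g k ∘ node (leaf (f i)))}
                      {λ i → total (f ∘ punchIn i) (h k ∘ node (leaf (f i)))})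
    (eventually-∀ λ i → total-eventually-< (f ∘ punchIn i)
      {λ k → g k ∘ node (leaf (f i))} {λ k → h k ∘ node (leaf (f i))} λ T T↭ →
      g<h (node (leaf (f i)) T) (↭-trans (prep (f i) T↭) (tabulate-punchIn f i)))

total-const : ∀ (f : Fin (suc m) → Fin n) q → total f (λ _ → q) ≡ count m * q
total-const {zero}  f q = sym (ℚ.*-identityˡ q)
total-const {suc m} f q = begin
  (∑ λ i → total (f ∘ punchIn i) λ _ → q)    ≡⟨ sum-cong-≗ {x = λ i → total (f ∘ punchIn i) λ _ → q} (λ i → total-const (f ∘ punchIn i) q) ⟩
  ∑ {suc (suc m)} (λ _ → count m * q)        ≡⟨ ∑-const (suc (suc m)) (count m * q) ⟩
  ι (2 ℕ.+ m) * (count m * q)                ≡⟨ ℚ.*-assoc (ι (2 ℕ.+ m)) (count m) q ⟨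
  count (suc m) * q                          ∎
  where open ≡-Reasoning

total-∑ : ∀ (f : Fin (suc m) → Fin n) {p} (g : Fin p → Tree n → ℚ) →
  total f (λ T → ∑ λ j → g j T) ≡ ∑ λ j → total f (g j)
total-∑ {zero}  f g = refl
total-∑ {suc m} f g = trans
  (sum-cong-≗ {x = λ i → total (f ∘ punchIn i) λ T → ∑ λ j → g j (node (leaf (f i)) T)}
    λ i → total-∑ (f ∘ punchIn i) λ j → g j ∘ node (leaf (f i)))
  (∑-comm λ i j → total (f ∘ punchIn i) (g j ∘ node (leaf (f i))))

total-*ˡ : ∀ (f : Fin (suc m) → Fin n) q (g : Tree n → ℚ) →
  total f (λ T → q * g T) ≡ q * total f g
total-*ˡ {zero}  f q g = refl
total-*ˡ {suc m} f q g = trans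
  (sum-cong-≗ {x = λ i → total (f ∘ punchIn i) λ T → q * g (node (leaf (f i)) T)}
    λ i → total-*ˡ (f ∘ punchIn i) q (g ∘ node (leaf (f i))))
  (sym (*-distribˡ-sum q λ i → total (f ∘ punchIn i) (g ∘ node (leaf (f i)))))

δ : Fin n → Fin n → ℚ
δ i j = if does (i Fin.≟ j) then 1ℚ else 0ℚ

δ-refl : ∀ (i : Fin n) → δ i i ≡ 1ℚ
δ-refl i rewrite dec-true (i Fin.≟ i) refl = refl

δ-≢ : ∀ {i j : Fin n} → i ≢ j → δ i j ≡ 0ℚ
δ-≢ {i = i} {j} i≢j rewrite dec-false (i Fin.≟ j) i≢j = refl

∑-δ : ∀ (j : Fin n) → ∑ (λ i → δ i j) ≡ 1ℚ
∑-δ {suc n} zero    = cong (1ℚ +_) (∑0 n)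
∑-δ {suc n} (suc j) = trans (ℚ.+-identityˡ _) (∑-δ j)

-- A leaf hanging from the root meets every other leaf only at the root, whose cluster is
-- everything. Both orders of the arguments occur, as either vertex of a pair may be the one
-- removed.
size-apart : ∀ (f : Fin (2 ℕ.+ m) → Fin n) → Injective _≡_ _≡_ f → ∀ {k j} → k ≢ j →
  ∀ T → leaves T ↭ tabulate (f ∘ punchIn k) →
  length (cluster (node (leaf (f k)) T) (f k) (f j)) ≡ 2 ℕ.+ m ×
  length (cluster (node (leaf (f k)) T) (f j) (f k)) ≡ 2 ℕ.+ m
size-apart {m} f f-inj {k} {j} k≢j T T↭ =
  trans (cong length (cluster-root (leaf (f k)) T (λ p → fj∉ (proj₂ p)) (λ p → fk∉ (proj₁ p)))) size-root ,
  trans (cong length (cluster-root (leaf (f k)) T (fj∉ ∘ proj₁) (fk∉ ∘ proj₂))) size-root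
  where
  fj∉ : f j ∉ leaves (leaf (f k))
  fj∉ (here fj≡fk) = k≢j (sym (f-inj fj≡fk))
  fk∉ : f k ∉ leaves T
  fk∉ fk∈T = let i , fk≡ = ∈-tabulate⁻ {f = f ∘ punchIn k} (∈-resp-↭ T↭ fk∈T) in Fin.punchInᵢ≢i k i (sym (f-inj fk≡))
  size-root : suc (length (leaves T)) ≡ 2 ℕ.+ m
  size-root = cong suc (trans (↭-length T↭) (List.length-tabulate (f ∘ punchIn k)))

size-below : ∀ (f : Fin (2 ℕ.+ m) → Fin n) → Injective _≡_ _≡_ f → ∀ k i j →
  ∀ T → leaves T ↭ tabulate (f ∘ punchIn k) →
  cluster (node (leaf (f k)) T) (f (punchIn k i)) (f (punchIn k j)) ≡ cluster T (f (punchIn k i)) (f (punchIn k j))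
size-below f f-inj k i j T T↭ = cluster-right (leaf (f k)) T
  (λ { (here fi≡fk , _) → Fin.punchInᵢ≢i k i (f-inj fi≡fk) })
  (∈-resp-↭ (↭-sym T↭) (∈-tabulate⁺ {f = f ∘ punchIn k} i)) (∈-resp-↭ (↭-sym T↭) (∈-tabulate⁺ {f = f ∘ punchIn k} j))

-- With N = m + 1 leaves, `count m` is N! and the equation says that the average cluster size is 2(N
-- + 1)/3, with denominators cleared. The induction starts from N = 1, where there is no pair; in
-- the step `C` is N! for the larger N.
total-size : ∀ {m} (f : Fin (suc m) → Fin n) → Injective _≡_ _≡_ f → ∀ {i j} → i ≢ j →
  ι 3 * total f (size (f i) (f j)) ≡ ι 2 * (ι (2 ℕ.+ m) * count m)
total-size {m = zero}  f f-inj {zero} {zero} i≢j = contradiction refl i≢j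
total-size {m = suc m} f f-inj {i} {j} i≢j = begin
  ι 3 * (∑ λ k → part k)                   ≡⟨ *-distribˡ-sum (ι 3) part ⟩
  (∑ λ k → ι 3 * part k)                   ≡⟨ sum-cong-≗ {x = λ k → ι 3 * part k} (λ k → value k (k Fin.≟ i) (k Fin.≟ j)) ⟩
  -- Each choice of the root leaf contributes 2C, and the two choices that separate the pair
  -- contribute another C, which the Kronecker deltas record.
  (∑ λ k → ι 2 * C + C * (δ k i + δ k j))  ≡⟨ ∑-distrib-+ (λ _ → ι 2 * C) (λ k → C * (δ k i + δ k j)) ⟩
  ∑ {2 ℕ.+ m} (λ _ → ι 2 * C) + (∑ λ k → C * (δ k i + δ k j))
    ≡⟨ cong₂ _+_ (∑-const (2 ℕ.+ m) (ι 2 * C)) (trans (sym (*-distribˡ-sum C (λ k → δ k i + δ k j)))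
         (cong (C *_) (trans (∑-distrib-+ (λ k → δ k i) (λ k → δ k j)) (cong₂ _+_ (∑-δ i) (∑-δ j))))) ⟩
  ι (2 ℕ.+ m) * (ι 2 * C) + C * 2ℚ
    ≡⟨ cong (λ t → ι (2 ℕ.+ m) * (t * C) + C * 2ℚ) ι-2 ⟩
  ι (2 ℕ.+ m) * (2ℚ * C) + C * 2ℚ
    ≡⟨ solve 2 (λ s C → s :* (con 2ℚ :* C) :+ C :* con 2ℚ := con 2ℚ :* ((con 1ℚ :+ s) :* C)) refl (ι (2 ℕ.+ m)) C ⟩
  2ℚ * ((1ℚ + ι (2 ℕ.+ m)) * C)
    ≡⟨ cong₂ (λ s t → s * (t * C)) (sym ι-2) (trans (cong (_+ ι (2 ℕ.+ m)) (sym ι-1)) (sym (ι-+ 1 (2 ℕ.+ m)))) ⟩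
  ι 2 * (ι (3 ℕ.+ m) * C)                  ∎
  where
  open ≡-Reasoning
  open +-*-Solver
  C : ℚ
  C = ι (2 ℕ.+ m) * count m
  part : Fin (2 ℕ.+ m) → ℚ
  part k = total (f ∘ punchIn k) (size (f i) (f j) ∘ node (leaf (f k)))
  apart : ∀ {k a b} → (∀ T → leaves T ↭ tabulate (f ∘ punchIn k) →
      length (cluster (node (leaf (f k)) T) (f i) (f j)) ≡ 2 ℕ.+ m) →
    a + b ≡ 1ℚ → ι 3 * part k ≡ ι 2 * C + C * (a + b)
  apart {k} {a} {b} root ab = begin
    ι 3 * part k                                   ≡⟨ cong (ι 3 *_) (total-cong (f ∘ punchIn k) λ T T↭ → cong ι (root T T↭)) ⟩
    ι 3 * total (f ∘ punchIn k) (λ _ → ι (2 ℕ.+ m))  ≡⟨ cong (ι 3 *_) (total-const (f ∘ punchIn k) (ι (2 ℕ.+ m))) ⟩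
    ι 3 * (count m * ι (2 ℕ.+ m))                  ≡⟨ cong₂ _*_ ι-3 (ℚ.*-comm (count m) (ι (2 ℕ.+ m))) ⟩
    3ℚ * C                                         ≡⟨ solve 1 (λ C → con 3ℚ :* C := con 2ℚ :* C :+ C :* con 1ℚ) refl C ⟩
    2ℚ * C + C * 1ℚ                                ≡⟨ cong₂ (λ s t → s * C + C * t) (sym ι-2) (sym ab) ⟩
    ι 2 * C + C * (a + b)                          ∎
  value : ∀ k → Dec (k ≡ i) → Dec (k ≡ j) → ι 3 * part k ≡ ι 2 * C + C * (δ k i + δ k j)
  value k (yes refl) _ = apart {k} {δ k i} {δ k j} (λ T T↭ → proj₁ (size-apart f f-inj i≢j T T↭))
    (trans (cong₂ _+_ (δ-refl i) (δ-≢ i≢j)) (ℚ.+-identityʳ 1ℚ))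
  value k (no k≢i) (yes refl) = apart {k} {δ k i} {δ k j} (λ T T↭ → proj₂ (size-apart f f-inj k≢i T T↭))
    (trans (cong₂ _+_ (δ-≢ k≢i) (δ-refl j)) (ℚ.+-identityˡ 1ℚ))
  -- The pair survives into the rest of the caterpillar, and the induction hypothesis for one leaf
  -- fewer is exactly 2C.
  value k (no k≢i) (no k≢j) = begin
    ι 3 * part k           ≡⟨ cong (ι 3 *_) (total-cong (f ∘ punchIn k) λ T T↭ → cong (ι ∘ length)
                                (below T T↭)) ⟩
    ι 3 * total (f ∘ punchIn k) (size (f (punchIn k i′)) (f (punchIn k j′)))
                           ≡⟨ total-size (f ∘ punchIn k) (Fin.punchIn-injective k _ _ ∘ f-inj)
                                (λ i′≡j′ → i≢j (trans (sym pi) (trans (cong (punchIn k) i′≡j′) pj))) ⟩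
    ι 2 * C                ≡⟨ ℚ.+-identityʳ (ι 2 * C) ⟨
    ι 2 * C + 0ℚ           ≡⟨ cong (ι 2 * C +_) (ℚ.*-zeroʳ C) ⟨
    ι 2 * C + C * 0ℚ       ≡⟨ cong (λ t → ι 2 * C + C * t) (cong₂ _+_ (δ-≢ k≢i) (δ-≢ k≢j)) ⟨
    ι 2 * C + C * (δ k i + δ k j) ∎
    where
    i′ = punchOut k≢i
    j′ = punchOut k≢j
    pi : punchIn k i′ ≡ i
    pi = Fin.punchIn-punchOut k≢i
    pj : punchIn k j′ ≡ j
    pj = Fin.punchIn-punchOut k≢j
    below : ∀ T → leaves T ↭ tabulate (f ∘ punchIn k) →
      cluster (node (leaf (f k)) T) (f i) (f j) ≡ cluster T (f (punchIn k i′)) (f (punchIn k j′))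
    below T T↭ = trans (cong₂ (λ x y → cluster (node (leaf (f k)) T) (f x) (f y)) (sym pi) (sym pj))
      (size-below f f-inj k i′ j′ T T↭)

-- The upper bound on the ratio

φ : ℕ → ℚ
φ n = ℤ.+ (2 ℕ.* (n ℕ.+ 1)) / 3

opaque
  unfolding ι

  ι-3*/3 : ∀ k → ι 3 * (ℤ.+ k / 3) ≡ ι k
  ι-3*/3 k = ℚ.toℚᵘ-injective (begin
    ℚ.toℚᵘ (ι 3 * (ℤ.+ k / 3))                  ≈⟨ ℚ.toℚᵘ-homo-* (ι 3) (ℤ.+ k / 3) ⟩
    ℚ.toℚᵘ (ι 3) ℚᵘ.* ℚ.toℚᵘ (ℤ.+ k / 3)        ≈⟨ ℚᵘ.*-congˡ {ℚ.toℚᵘ (ι 3)} (toℚᵘ-/ (ℤ.+ k) 3) ⟩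
    (ℤ.+ 3 ℚᵘ./ 1) ℚᵘ.* (ℤ.+ k ℚᵘ./ 3)          ≈⟨ ℚᵘ.*≡* (trans (ℤ.*-identityʳ (ℤ.+ 3 ℤ.* ℤ.+ k)) (ℤ.*-comm (ℤ.+ 3) (ℤ.+ k))) ⟩
    ℤ.+ k ℚᵘ./ 1                                ≈⟨ toℚᵘ-/ (ℤ.+ k) 1 ⟨
    ℚ.toℚᵘ (ι k)                                ∎)
    where open ℚᵘ.≃-Reasoning

ι-3*φ : ∀ n → ι 3 * φ n ≡ ι 2 * ι (suc n)
ι-3*φ n = trans (ι-3*/3 (2 ℕ.* (n ℕ.+ 1))) (trans (cong (λ k → ι (2 ℕ.* k)) (ℕ.+-comm n 1)) (ι-* 2 (suc n)))

φ-pos : ∀ n → 0ℚ < φ n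
φ-pos n = ℚ.*-cancelˡ-<-nonNeg (ι 3) {{nonNegative (0≤ι 3)}}
  (subst₂ _<_ (sym (ℚ.*-zeroʳ (ι 3))) (sym (ι-3*φ n)) (pos*pos (0<ι 1) (0<ι n)))

dasguptaCost : WeightedGraph n → Tree n → ℝ
dasguptaCost G T = edgeSum G λ x y → fromℕ (length (cluster T x y))

module _ (G : WeightedGraph n) where

  weightedSizes : ℕ → Tree n → ℚ
  weightedSizes k T = ∑ λ x → ∑ λ y → coefficient G k x y * size x y T

  seq-dasguptaCost : ∀ T k → seq (dasguptaCost G T) k ≡ weightedSizes k T
  seq-dasguptaCost T k = trans (seq-edgeSum G (λ x y → fromℕ (length (cluster T x y))) k)
    (sum-cong-≗ {x = λ x → ∑ λ y → coefficient G k x y * (ℤ.+ length (cluster T x y) / 1)}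
                {λ x → ∑ λ y → coefficient G k x y * size x y T} λ x →
     sum-cong-≗ {x = λ y → coefficient G k x y * (ℤ.+ length (cluster T x y) / 1)}
                {λ y → coefficient G k x y * size x y T} λ y →
     cong (coefficient G k x y *_) (ι-/ (length (cluster T x y))))

-- After the interchange of sums every pair of distinct vertices has the same total size, which
-- factors out and leaves the total weight. On the diagonal, where `total-size` is silent, the
-- coefficient vanishes.
total-weightedSizes : ∀ (G : WeightedGraph (suc m)) k →
  ι 3 * total id (weightedSizes G k) ≡ seq (totalWeight G) k * (ι 2 * (ι (2 ℕ.+ m) * count m))
total-weightedSizes {m} G k = begin
  ι 3 * total id (weightedSizes G k)
    ≡⟨ cong (ι 3 *_) (trans (total-∑ id λ x T → ∑ λ y → a x y * size x y T)
         (sum-cong-≗ {x = λ x → total id λ T → ∑ λ y → a x y * size x y T} {λ x → ∑ λ y → a x y * t x y} λ x →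
           trans (total-∑ id λ y T → a x y * size x y T)
             (sum-cong-≗ {x = λ y → total id λ T → a x y * size x y T} {λ y → a x y * t x y} λ y →
               total-*ˡ id (a x y) (size x y)))) ⟩
  ι 3 * (∑ λ x → ∑ λ y → a x y * t x y)
    ≡⟨ trans (*-distribˡ-sum (ι 3) λ x → ∑ λ y → a x y * t x y)
         (sum-cong-≗ {x = λ x → ι 3 * ∑ λ y → a x y * t x y} {λ x → ∑ λ y → a x y * 1ℚ * K} λ x →
           trans (*-distribˡ-sum (ι 3) λ y → a x y * t x y)
             (sum-cong-≗ {x = λ y → ι 3 * (a x y * t x y)} {λ y → a x y * 1ℚ * K} λ y → pair x y (x Fin.≟ y))) ⟩
  (∑ λ x → ∑ λ y → a x y * 1ℚ * K)
    ≡⟨ sum-cong-≗ {x = λ x → ∑ (λ y → a x y * 1ℚ) * K} {λ x → ∑ λ y → a x y * 1ℚ * K} (λ x → *-distribʳ-sum K λ y → a x y * 1ℚ) ⟨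
  (∑ λ x → ∑ (λ y → a x y * 1ℚ) * K)
    ≡⟨ *-distribʳ-sum K (λ x → ∑ λ y → a x y * 1ℚ) ⟨
  (∑ λ x → ∑ λ y → a x y * 1ℚ) * K
    ≡⟨ cong (_* K) (seq-edgeSum G (λ _ _ → 1ᴿ) k) ⟨
  seq (totalWeight G) k * K ∎
  where
  open ≡-Reasoning
  open +-*-Solver
  K : ℚ
  K = ι 2 * (ι (2 ℕ.+ m) * count m)
  a : Fin (suc m) → Fin (suc m) → ℚ
  a = coefficient G k
  t : Fin (suc m) → Fin (suc m) → ℚ
  t x y = total id (size x y)
  pair : ∀ x y → Dec (x ≡ y) → ι 3 * (a x y * t x y) ≡ a x y * 1ℚ * K
  pair x y (no x≢y)   = begin
    ι 3 * (a x y * t x y)    ≡⟨ solve 3 (λ s a t → s :* (a :* t) := a :* con 1ℚ :* (s :* t)) refl (ι 3) (a x y) (t x y) ⟩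
    a x y * 1ℚ * (ι 3 * t x y)    ≡⟨ cong (a x y * 1ℚ *_) (total-size id id x≢y) ⟩
    a x y * 1ℚ * K                ∎
  pair x .x (yes refl) = begin
    ι 3 * (a x x * t x x)    ≡⟨ cong (λ q → ι 3 * (q * t x x)) (coefficient-zero G k x) ⟩
    ι 3 * (0ℚ * t x x)       ≡⟨ solve 3 (λ s t K → s :* (con 0ℚ :* t) := con 0ℚ :* con 1ℚ :* K) refl (ι 3) (t x x) K ⟩
    0ℚ * 1ℚ * K              ≡⟨ cong (λ q → q * 1ℚ * K) (coefficient-zero G k x) ⟨
    a x x * 1ℚ * K           ∎

-- The best hierarchy costs at most the average over all caterpillars.
≤dasguptaCost⇒≤factor*totalWeight : ∀ (G : WeightedGraph (suc m)) {D} →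
  (∀ T → IsHierarchy T → D ≤ᴿ dasguptaCost G T) → D ≤ᴿ factor (suc m) *ᴿ totalWeight G
≤dasguptaCost⇒≤factor*totalWeight {m} G {D} D≤ ε 0<ε =
  eventually-map (λ {k} → average k) (total-eventually-< id {λ k _ → seq D k - ε} {weightedSizes G} λ T T↭ →
    eventually-map (λ {k} → below T k) (D≤ T T↭ ε 0<ε))
  where
  open +-*-Solver
  below : ∀ T k → seq D k < seq (dasguptaCost G T) k + ε → seq D k - ε < weightedSizes G k T
  below T k lt = subst (seq D k - ε <_)
    (trans (solve 2 (λ c ε → c :+ ε :- ε := c) refl (seq (dasguptaCost G T) k) ε) (seq-dasguptaCost G T k))
    (ℚ.+-monoˡ-< (ℚ.- ε) lt)
  average : ∀ k → total {m} id (λ _ → seq D k - ε) < total id (weightedSizes G k) →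
    seq D k < φ (suc m) * seq (totalWeight G) k + ε
  average k lt = subst (_< φ (suc m) * w + ε) (solve 2 (λ d ε → d :- ε :+ ε := d) refl (seq D k) ε)
    -- Cancelling three times the number of caterpillars takes the place of forming the average.
    (ℚ.+-monoˡ-< ε (ℚ.*-cancelˡ-<-nonNeg (ι 3 * count m)
      {{nonNegative (ℚ.<⇒≤ (pos*pos (0<ι 2) (count-pos m)))}}
      (subst₂ _<_ left right (ℚ.*-monoʳ-<-pos (ι 3) {{positive (0<ι 2)}} lt))))
    where
    open ≡-Reasoning
    w = seq (totalWeight G) k
    left : ι 3 * total {m} id (λ _ → seq D k - ε) ≡ ι 3 * count m * (seq D k - ε)
    left = trans (cong (ι 3 *_) (total-const {m} id (seq D k - ε))) (sym (ℚ.*-assoc (ι 3) (count m) (seq D k - ε)))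
    right : ι 3 * total id (weightedSizes G k) ≡ ι 3 * count m * (φ (suc m) * w)
    right = begin
      ι 3 * total id (weightedSizes G k)    ≡⟨ total-weightedSizes G k ⟩
      w * (ι 2 * (ι (2 ℕ.+ m) * count m))
        ≡⟨ solve 4 (λ w s t c → w :* (s :* (t :* c)) := (s :* t) :* (c :* w)) refl w (ι 2) (ι (2 ℕ.+ m)) (count m) ⟩
      (ι 2 * ι (2 ℕ.+ m)) * (count m * w)   ≡⟨ cong (_* (count m * w)) (ι-3*φ (suc m)) ⟨
      (ι 3 * φ (suc m)) * (count m * w)
        ≡⟨ solve 4 (λ s f c w → (s :* f) :* (c :* w) := s :* c :* (f :* w)) refl (ι 3) (φ (suc m)) (count m) w ⟩
      ι 3 * count m * (φ (suc m) * w)       ∎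

-- Eventually F is at least ε₀, so its reciprocal is at most 1/ε₀; an error of ε ε₀ before the
-- division therefore becomes at most ε after it.
≤*⇒/≤ : ∀ {D F} c (F>0 : 0ᴿ <ᴿ F) → D ≤ᴿ fromℚ c *ᴿ F → D /ᴿ F [ F>0 ] ≤ᴿ fromℚ c
≤*⇒/≤ {D} {F} c (ε₀ , 0<ε₀ , F≥ε₀) D≤cF ε 0<ε =
  eventually-zip (λ {k} → divided k) F≥ε₀ (D≤cF (ε * ε₀) (pos*pos 0<ε 0<ε₀))
  where
  open +-*-Solver
  divided : ∀ k → 0ℚ + ε₀ ℚ.≤ seq F k → seq D k < c * seq F k + ε * ε₀ →
    seq D k * recipMax 0<ε₀ (seq F k) < c + ε
  divided k ε₀≤F D<cF = ℚ.<-≤-trans (ℚ.*-monoˡ-<-pos r {{recipMax-pos 0<ε₀ (seq F k)}} D<cF)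
    (ℚ.≤-trans (ℚ.≤-reflexive expand)
      (ℚ.+-monoʳ-≤ c (subst (ε * (ε₀ * r) ℚ.≤_) (ℚ.*-identityʳ ε)
        (ℚ.*-monoˡ-≤-nonNeg ε {{nonNegative (ℚ.<⇒≤ 0<ε)}} ε₀r≤1))))
    where
    r = recipMax 0<ε₀ (seq F k)
    ε₀≤ : ε₀ ℚ.≤ seq F k
    ε₀≤ = subst (ℚ._≤ seq F k) (ℚ.+-identityˡ ε₀) ε₀≤F
    Fr≡1 : seq F k * r ≡ 1ℚ
    Fr≡1 = trans (cong (_* r) (sym (ℚ.p≥q⇒p⊔q≡p ε₀≤))) (recipMax-inverse 0<ε₀ (seq F k))
    ε₀r≤1 : ε₀ * r ℚ.≤ 1ℚ
    ε₀r≤1 = subst (ε₀ * r ℚ.≤_) Fr≡1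
      (ℚ.*-monoʳ-≤-nonNeg r {{ℚ.pos⇒nonNeg r {{recipMax-pos 0<ε₀ (seq F k)}}}} ε₀≤)
    expand : (c * seq F k + ε * ε₀) * r ≡ c + ε * (ε₀ * r)
    expand = trans
      (solve 5 (λ c f e z r → (c :* f :+ e :* z) :* r := c :* (f :* r) :+ e :* (z :* r)) refl c (seq F k) ε ε₀ r)
      (cong (_+ ε * (ε₀ * r)) (trans (cong (c *_) Fr≡1) (ℚ.*-identityʳ c)))

edge-distance : ∀ (G : WeightedGraph n) {x y} → WeightedGraph.Edge G x y → IsDistance G x y 1
edge-distance G e = step e here , λ where
  zero    here → contradiction refl (WeightedGraph.loopless G e)
  (suc j) _    → ℕ.s≤s ℕ.z≤n

totalWeight≤edgeSum : ∀ (G : WeightedGraph n) {u} → DominatesDistance G u → totalWeight G ≤ᴿ edgeSum G u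
totalWeight≤edgeSum G {u} dom = edgeSum-mono-≤ G {λ _ _ → 1ᴿ} {u} λ {x} {y} e → dom x y 1 (edge-distance G e)

totalWeight≤OPT-free : ∀ (G : WeightedGraph n) {F} → IsOPT-free G F → totalWeight G ≤ᴿ F
totalWeight≤OPT-free G {F} ((u , (_ , dom) , cost≈F) , _) =
  ≤ᴿ-trans {totalWeight G} {edgeSum G u} {F} (totalWeight≤edgeSum G {u} dom) (≈ᴿ⇒≤ᴿ {edgeSum G u} {F} cost≈F)

ratio≤factor : ∀ (G : WeightedGraph (suc m)) {ρ} → IsRatio G ρ → ρ ≤ᴿ factor (suc m)
ratio≤factor {m} G {ρ} (D , F , (_ , D≤) , optF , F>0 , D/F≈ρ) =
  ≤ᴿ-trans {ρ} {D /ᴿ F [ F>0 ]} {factor (suc m)}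
    (≈ᴿ⇒≤ᴿ {ρ} {D /ᴿ F [ F>0 ]} (≈ᴿ-sym {D /ᴿ F [ F>0 ]} {ρ} D/F≈ρ))
    (≤*⇒/≤ {D} {F} (φ (suc m)) F>0
      (≤ᴿ-trans {D} {factor (suc m) *ᴿ totalWeight G} {factor (suc m) *ᴿ F}
        (≤dasguptaCost⇒≤factor*totalWeight G {D} D≤)
        (*ᴿ-monoˡ-≤ (factor (suc m)) {totalWeight G} {F} factor>0 (totalWeight≤OPT-free G {F} optF))))
  where
  factor>0 : 0ᴿ <ᴿ factor (suc m)
  factor>0 = φ (suc m) , φ-pos (suc m) , always λ _ → ℚ.≤-reflexive (ℚ.+-identityˡ (φ (suc m)))

-- Complete graphs

∑ℕ : List A → (A → ℕ) → ℕ
∑ℕ xs f = ℕ.sum (map f xs)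

∑ℕ-cong : ∀ (xs : List A) {f g} → (∀ {x} → x ∈ xs → f x ≡ g x) → ∑ℕ xs f ≡ ∑ℕ xs g
∑ℕ-cong []       _   = refl
∑ℕ-cong (x ∷ xs) f≡g = cong₂ ℕ._+_ (f≡g (here refl)) (∑ℕ-cong xs (f≡g ∘ there))

∑ℕ-++ : ∀ (xs ys : List A) f → ∑ℕ (xs ++ ys) f ≡ ∑ℕ xs f ℕ.+ ∑ℕ ys f
∑ℕ-++ xs ys f = trans (cong ℕ.sum (List.map-++ f xs ys)) (sum-++ (map f xs) (map f ys))

∑ℕ-const : ∀ (xs : List A) c → ∑ℕ xs (λ _ → c) ≡ length xs ℕ.* c
∑ℕ-const []       c = refl
∑ℕ-const (_ ∷ xs) c = cong (c ℕ.+_) (∑ℕ-const xs c)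

∑ℕ-+ : ∀ (xs : List A) f g → ∑ℕ xs (λ x → f x ℕ.+ g x) ≡ ∑ℕ xs f ℕ.+ ∑ℕ xs g
∑ℕ-+ []       f g = refl
∑ℕ-+ (x ∷ xs) f g = trans (cong (f x ℕ.+ g x ℕ.+_) (∑ℕ-+ xs f g))
  (solve 4 (λ a b c d → (a :+ b) :+ (c :+ d) := (a :+ c) :+ (b :+ d)) refl (f x) (g x) (∑ℕ xs f) (∑ℕ xs g))
  where open ℕ-Solver.+-*-Solver

∑ℕ-↭ : ∀ {xs ys : List A} f → xs ↭ ys → ∑ℕ xs f ≡ ∑ℕ ys f
∑ℕ-↭ f xs↭ys = sum-↭ (↭.map⁺ f xs↭ys)

unique-++⁻ : ∀ (xs : List A) {ys} → Unique (xs ++ ys) → Unique xs × Unique ys × Disjoint xs ys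
unique-++⁻ []       ys!          = [] , ys! , λ ()
unique-++⁻ (x ∷ xs) (x∉ ∷ xs++ys!) =
  let xs! , ys! , xs#ys = unique-++⁻ xs xs++ys!
  in All.++⁻ˡ xs x∉ ∷ xs! , ys! , λ where
       (here refl , x∈ys)  → All.lookup (All.++⁻ʳ xs x∉) x∈ys refl
       (there z∈xs , z∈ys) → xs#ys (z∈xs , z∈ys)

-- Ordered pairs with the diagonal, instead of edges with x < y: in this form the sum splits along
-- the two subtrees of a node without reference to the order of the vertices.
clusterSum : Tree n → ℕ
clusterSum T = ∑ℕ (leaves T) λ x → ∑ℕ (leaves T) λ y → length (cluster T x y)

-- The double sum falls into four blocks. Pairs within one subtree keep their cluster, while pairs
-- across the subtrees meet at the root, in a cluster of size a + b.
clusterSum-node : ∀ (l r : Tree n) → Disjoint (leaves l) (leaves r) →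
  let a = length (leaves l); b = length (leaves r) in
  clusterSum (node l r) ≡ clusterSum l ℕ.+ a ℕ.* (b ℕ.* (a ℕ.+ b)) ℕ.+ (b ℕ.* (a ℕ.* (a ℕ.+ b)) ℕ.+ clusterSum r)
clusterSum-node l r l#r = trans (∑ℕ-++ L R _) (cong₂ ℕ._+_
  (trans (∑ℕ-cong L λ x∈L → trans (∑ℕ-++ L R _) (cong₂ ℕ._+_
      (∑ℕ-cong L λ y∈L → cong length (cluster-left l r x∈L y∈L))
      (trans (∑ℕ-cong R λ y∈R → root (λ (_ , y∈L) → l#r (y∈L , y∈R)) (λ (x∈R , _) → l#r (x∈L , x∈R))) (∑ℕ-const R N))))
    (trans (∑ℕ-+ L _ _) (cong (clusterSum l ℕ.+_) (∑ℕ-const L _))))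
  (trans (∑ℕ-cong R λ x∈R → trans (∑ℕ-++ L R _) (cong₂ ℕ._+_
      (trans (∑ℕ-cong L λ y∈L → root (λ (x∈L , _) → l#r (x∈L , x∈R)) (λ (_ , y∈R) → l#r (y∈L , y∈R))) (∑ℕ-const L N))
      (∑ℕ-cong R λ y∈R → cong length (cluster-right l r (λ (x∈L , _) → l#r (x∈L , x∈R)) x∈R y∈R))))
    (trans (∑ℕ-+ R _ _) (cong (ℕ._+ clusterSum r) (∑ℕ-const R _)))))
  where
  L = leaves l
  R = leaves r
  N = length L ℕ.+ length R
  root : ∀ {x y} → ¬ (x ∈ L × y ∈ L) → ¬ (x ∈ R × y ∈ R) → length (cluster (node l r) x y) ≡ N
  root ∉l ∉r = trans (cong length (cluster-root l r ∉l ∉r)) (List.length-++ L)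

-- The shape of the tree drops out, because the cross terms 6ab(a + b) are exactly what 2a^3 + 2b^3
-- lacks to be 2(a + b)^3.
3*clusterSum : ∀ (T : Tree n) → Unique (leaves T) →
  let a = length (leaves T) in 3 ℕ.* clusterSum T ≡ 2 ℕ.* (a ℕ.* (a ℕ.* a)) ℕ.+ a
3*clusterSum (leaf x)   _     = refl
3*clusterSum (node l r) lr! =
  let l! , r! , l#r = unique-++⁻ (leaves l) lr!
      a = length (leaves l)
      b = length (leaves r)
      c = length (leaves (node l r))
      s = clusterSum l
      t = clusterSum r
  in begin
    3 ℕ.* clusterSum (node l r)
      ≡⟨ cong (3 ℕ.*_) (clusterSum-node l r l#r) ⟩
    3 ℕ.* (s ℕ.+ a ℕ.* (b ℕ.* (a ℕ.+ b)) ℕ.+ (b ℕ.* (a ℕ.* (a ℕ.+ b)) ℕ.+ t))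
      ≡⟨ solve 4 (λ s t a b →
           con 3 :* (s :+ a :* (b :* (a :+ b)) :+ (b :* (a :* (a :+ b)) :+ t)) :=
           con 3 :* s :+ con 3 :* t :+ con 6 :* (a :* (b :* (a :+ b)))) refl s t a b ⟩
    3 ℕ.* s ℕ.+ 3 ℕ.* t ℕ.+ 6 ℕ.* (a ℕ.* (b ℕ.* (a ℕ.+ b)))
      ≡⟨ cong₂ (λ p q → p ℕ.+ q ℕ.+ 6 ℕ.* (a ℕ.* (b ℕ.* (a ℕ.+ b)))) (3*clusterSum l l!) (3*clusterSum r r!) ⟩
    2 ℕ.* (a ℕ.* (a ℕ.* a)) ℕ.+ a ℕ.+ (2 ℕ.* (b ℕ.* (b ℕ.* b)) ℕ.+ b) ℕ.+ 6 ℕ.* (a ℕ.* (b ℕ.* (a ℕ.+ b)))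
      ≡⟨ solve 2 (λ a b →
           con 2 :* (a :* (a :* a)) :+ a :+ (con 2 :* (b :* (b :* b)) :+ b) :+ con 6 :* (a :* (b :* (a :+ b))) :=
           con 2 :* ((a :+ b) :* ((a :+ b) :* (a :+ b))) :+ (a :+ b)) refl a b ⟩
    2 ℕ.* ((a ℕ.+ b) ℕ.* ((a ℕ.+ b) ℕ.* (a ℕ.+ b))) ℕ.+ (a ℕ.+ b)
      ≡⟨ cong (λ c → 2 ℕ.* (c ℕ.* (c ℕ.* c)) ℕ.+ c) (List.length-++ (leaves l)) ⟨
    2 ℕ.* (c ℕ.* (c ℕ.* c)) ℕ.+ c ∎
  where
  open ≡-Reasoning
  open ℕ-Solver.+-*-Solver

both∈-sym : ∀ (T : Tree n) x y → does (both∈? x y T) ≡ does (both∈? y x T)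
both∈-sym T x y = ∧-comm (does (x ∈? leaves T)) (does (y ∈? leaves T))
  where open import Data.List.Membership.DecPropositional (Fin._≟_ {_}) using (_∈?_)

cluster-sym : ∀ (T : Tree n) x y → cluster T x y ≡ cluster T y x
cluster-sym (leaf z)   x y = refl
cluster-sym (node l r) x y
  rewrite both∈-sym l x y | both∈-sym r x y | cluster-sym l x y | cluster-sym r x y = refl

cluster-diagonal : ∀ (T : Tree n) {x} → x ∈ leaves T → length (cluster T x x) ≡ 1
cluster-diagonal (leaf z)   _ = refl
cluster-diagonal (node l r) {x} x∈ with both∈? x x l
... | yes (x∈l , _) = trans (cong length (cluster-left l r x∈l x∈l)) (cluster-diagonal l x∈l)
... | no ∉l with ∈-++⁻ (leaves l) x∈
...   | inj₁ x∈l = contradiction (x∈l , x∈l) ∉l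
...   | inj₂ x∈r = trans (cong length (cluster-right l r ∉l x∈r x∈r)) (cluster-diagonal r x∈r)

hierarchy-unique : ∀ (T : Tree n) → IsHierarchy T → Unique (leaves T)
hierarchy-unique {n} T T↭ = ↭ₛ.Unique-resp-↭ (setoid (Fin n)) (↭⇒↭ₛ (↭-sym T↭)) (Unique.allFin⁺ n)

hierarchy-length : ∀ (T : Tree n) → IsHierarchy T → length (leaves T) ≡ n
hierarchy-length T T↭ = trans (↭-length T↭) (List.length-tabulate id)

ι-∑ℕ-tabulate : ∀ (g : Fin n → A) (f : A → ℕ) → ι (∑ℕ (tabulate g) f) ≡ ∑ λ i → ι (f (g i))
ι-∑ℕ-tabulate {zero}  g f = ι-0
ι-∑ℕ-tabulate {suc n} g f = trans (ι-+ (f (g zero)) _) (cong (ι (f (g zero)) +_) (ι-∑ℕ-tabulate (g ∘ suc) f))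

∑-size : ∀ (T : Tree n) → IsHierarchy T → (∑ λ x → ∑ λ y → size x y T) ≡ ι (clusterSum T)
∑-size {n} T T↭ = sym (begin
  ι (clusterSum T)
    ≡⟨ cong ι (∑ℕ-↭ (λ x → ∑ℕ (leaves T) λ y → length (cluster T x y)) T↭) ⟩
  ι (∑ℕ (allFin n) λ x → ∑ℕ (leaves T) λ y → length (cluster T x y))
    ≡⟨ ι-∑ℕ-tabulate id (λ x → ∑ℕ (leaves T) λ y → length (cluster T x y)) ⟩
  (∑ λ x → ι (∑ℕ (leaves T) λ y → length (cluster T x y)))
    ≡⟨ sum-cong-≗ {x = λ x → ι (∑ℕ (leaves T) λ y → length (cluster T x y))} {λ x → ∑ λ y → size x y T} (λ x →
         trans (cong ι (∑ℕ-↭ (λ y → length (cluster T x y)) T↭)) (ι-∑ℕ-tabulate id (λ y → length (cluster T x y)))) ⟩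
  (∑ λ x → ∑ λ y → size x y T) ∎)
  where open ≡-Reasoning

module _ (n : ℕ) where

  private
    G = complete n

  complete-coefficient-< : ∀ k {x y} → x Fin.< y → coefficient G k x y ≡ 1ℚ
  complete-coefficient-< k {x} {y} x<y = value ((x Fin.<? y) ×-dec WeightedGraph.edge? G x y)
    where
    value : (d : Dec (x Fin.< y × x ≢ y)) → coefficientWhen G d k ≡ 1ℚ
    value (yes _) = refl
    value (no ¬d) = contradiction (x<y , Fin.<⇒≢ x<y) ¬d

  complete-coefficient-≮ : ∀ k {x y} → ¬ x Fin.< y → coefficient G k x y ≡ 0ℚ
  complete-coefficient-≮ k {x} {y} x≮y = value ((x Fin.<? y) ×-dec WeightedGraph.edge? G x y)
    where
    value : (d : Dec (x Fin.< y × x ≢ y)) → coefficientWhen G d k ≡ 0ℚ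
    value (yes (x<y , _)) = contradiction x<y x≮y
    value (no _)          = refl

  -- On the complete graph the coefficients are the indicator of x < y, so a symmetric matrix
  -- consists of the upper triangle, its mirror image and a diagonal of n ones.
  ∑∑-split : ∀ k (s : Fin n → Fin n → ℚ) → (∀ x y → s x y ≡ s y x) → (∀ x → s x x ≡ 1ℚ) →
    let p = ∑ λ x → ∑ λ y → coefficient G k x y * s x y in
    (∑ λ x → ∑ λ y → s x y) ≡ p + p + ι n
  ∑∑-split k s s-sym s-diag = begin
    (∑ λ x → ∑ λ y → s x y)
      ≡⟨ ∑∑-cong (λ x y → s x y) (λ x y → c x y * s x y + c y x * s y x + δ x y) (λ x y → pointwise x y (Fin.<-cmp x y)) ⟩
    (∑ λ x → ∑ λ y → c x y * s x y + c y x * s y x + δ x y)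
      ≡⟨ ∑∑-+ (λ x y → c x y * s x y + c y x * s y x) δ ⟩
    (∑ λ x → ∑ λ y → c x y * s x y + c y x * s y x) + (∑ {n} λ x → ∑ {n} λ y → δ x y)
      ≡⟨ cong₂ _+_ (∑∑-+ (λ x y → c x y * s x y) (λ x y → c y x * s y x))
           (trans (∑-comm {n} {n} (δ {n})) (trans (sum-cong-≗ {n} {λ y → ∑ {n} λ x → δ x y} {λ _ → 1ℚ} ∑-δ)
             (trans (∑-const n 1ℚ) (ℚ.*-identityʳ (ι n))))) ⟩
    (∑ λ x → ∑ λ y → c x y * s x y) + (∑ λ x → ∑ λ y → c y x * s y x) + ι n
      ≡⟨ cong (λ q → (∑ λ x → ∑ λ y → c x y * s x y) + q + ι n) (∑-comm {n} {n} λ x y → c y x * s y x) ⟩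
    (∑ λ x → ∑ λ y → c x y * s x y) + (∑ λ x → ∑ λ y → c x y * s x y) + ι n ∎
    where
    open ≡-Reasoning
    c : Fin n → Fin n → ℚ
    c = coefficient G k
    ∑∑-cong : ∀ (f g : Fin n → Fin n → ℚ) → (∀ x y → f x y ≡ g x y) → (∑ λ x → ∑ λ y → f x y) ≡ (∑ λ x → ∑ λ y → g x y)
    ∑∑-cong f g f≡g = sum-cong-≗ {x = λ x → ∑ (f x)} {λ x → ∑ (g x)} λ x → sum-cong-≗ {x = f x} {g x} (f≡g x)
    ∑∑-+ : ∀ (f g : Fin n → Fin n → ℚ) → (∑ λ x → ∑ λ y → f x y + g x y) ≡ (∑ λ x → ∑ λ y → f x y) + (∑ λ x → ∑ λ y → g x y)
    ∑∑-+ f g = trans (sum-cong-≗ {x = λ x → ∑ λ y → f x y + g x y} {λ x → ∑ (f x) + ∑ (g x)} λ x → ∑-distrib-+ (f x) (g x))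
      (∑-distrib-+ (λ x → ∑ (f x)) (λ x → ∑ (g x)))
    combine : ∀ {x y p q r} t → c x y ≡ p → c y x ≡ q → δ x y ≡ r →
      t ≡ p * s x y + q * s y x + r → t ≡ c x y * s x y + c y x * s y x + δ x y
    combine t refl refl refl eq = eq
    pointwise : ∀ x y → Tri (x Fin.< y) (x ≡ y) (y Fin.< x) → s x y ≡ c x y * s x y + c y x * s y x + δ x y
    pointwise x y (tri< x<y x≢y y≮x) = combine (s x y) (complete-coefficient-< k x<y) (complete-coefficient-≮ k y≮x) (δ-≢ x≢y)
      (solve 2 (λ s t → s := con 1ℚ :* s :+ con 0ℚ :* t :+ con 0ℚ) refl (s x y) (s y x))
      where open +-*-Solver
    pointwise x .x (tri≈ x≮x refl _) = combine (s x x) (complete-coefficient-≮ k x≮x) (complete-coefficient-≮ k x≮x) (δ-refl x)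
      (trans (s-diag x) (solve 1 (λ s → con 1ℚ := con 0ℚ :* s :+ con 0ℚ :* s :+ con 1ℚ) refl (s x x)))
      where open +-*-Solver
    pointwise x y (tri> x≮y x≢y y<x) = combine (s x y) (complete-coefficient-≮ k x≮y) (complete-coefficient-< k y<x) (δ-≢ x≢y)
      (trans (s-sym x y) (solve 2 (λ s t → t := con 0ℚ :* s :+ con 1ℚ :* t :+ con 0ℚ) refl (s x y) (s y x)))
      where open +-*-Solver

  -- Splitting the cluster sizes and the constant 1 in this way gives 3(2P + n) = 2n^3 + n and n^2 =
  -- 2W + n. Using the second equation twice, first in n^3 and then in the n^2 that appears, leaves
  -- 3P = 2(n + 1)W.
  dasguptaCost-complete : ∀ T → IsHierarchy T → ∀ k →
    seq (dasguptaCost G T) k ≡ seq (factor n *ᴿ totalWeight G) k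
  dasguptaCost-complete T T↭ k = begin
    seq (dasguptaCost G T) k                  ≡⟨ seq-dasguptaCost G T k ⟩
    P                                         ≡⟨ third P ⟩
    (ℤ.+ 1 / 3) * (ι 3 * P)                   ≡⟨ cong ((ℤ.+ 1 / 3) *_) triple ⟩
    (ℤ.+ 1 / 3) * (ι 2 * ι (suc n) * W)       ≡⟨ cong (λ q → (ℤ.+ 1 / 3) * (q * W)) (ι-3*φ n) ⟨
    (ℤ.+ 1 / 3) * (ι 3 * φ n * W)             ≡⟨ cong ((ℤ.+ 1 / 3) *_) (ℚ.*-assoc (ι 3) (φ n) W) ⟩
    (ℤ.+ 1 / 3) * (ι 3 * (φ n * W))           ≡⟨ third (φ n * W) ⟨
    φ n * W                                   ∎
    where
    open ≡-Reasoning
    open +-*-Solver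
    N = ι n
    W = seq (totalWeight G) k
    P = weightedSizes G k T
    third : ∀ q → q ≡ (ℤ.+ 1 / 3) * (ι 3 * q)
    third q = begin
      q                          ≡⟨ ℚ.*-identityˡ q ⟨
      1ℚ * q                     ≡⟨ cong (_* q) (trans (ι-3*/3 1) ι-1) ⟨
      ι 3 * (ℤ.+ 1 / 3) * q      ≡⟨ solve 3 (λ a b q → a :* b :* q := b :* (a :* q)) refl (ι 3) (ℤ.+ 1 / 3) q ⟩
      (ℤ.+ 1 / 3) * (ι 3 * q)    ∎
    leaf∈ : ∀ x → x ∈ leaves T
    leaf∈ x = ∈-resp-↭ (↭-sym T↭) (∈-tabulate⁺ {f = id} x)
    sizes : 3ℚ * (P + P + N) ≡ 2ℚ * (N * (N * N)) + N
    sizes = begin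
      3ℚ * (P + P + N)
        ≡⟨ cong (3ℚ *_) (∑∑-split k (λ x y → size x y T) (λ x y → cong (ι ∘ length) (cluster-sym T x y))
             (λ x → trans (cong ι (cluster-diagonal T (leaf∈ x))) ι-1)) ⟨
      3ℚ * (∑ λ x → ∑ λ y → size x y T)
        ≡⟨ cong₂ _*_ (sym ι-3) (∑-size T T↭) ⟩
      ι 3 * ι (clusterSum T)
        ≡⟨ ι-* 3 (clusterSum T) ⟨
      ι (3 ℕ.* clusterSum T)
        ≡⟨ cong ι (trans (3*clusterSum T (hierarchy-unique T T↭))
             (cong (λ a → 2 ℕ.* (a ℕ.* (a ℕ.* a)) ℕ.+ a) (hierarchy-length T T↭))) ⟩
      ι (2 ℕ.* (n ℕ.* (n ℕ.* n)) ℕ.+ n)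
        ≡⟨ trans (ι-+ (2 ℕ.* (n ℕ.* (n ℕ.* n))) n) (cong (_+ N) (trans (ι-* 2 (n ℕ.* (n ℕ.* n)))
             (cong₂ _*_ ι-2 (trans (ι-* n (n ℕ.* n)) (cong (N *_) (ι-* n n)))))) ⟩
      2ℚ * (N * (N * N)) + N ∎
    weights : N * N ≡ W + W + N
    weights = begin
      N * N
        ≡⟨ ∑-const n N ⟨
      ∑ {n} (λ _ → N)
        ≡⟨ sum-cong-≗ {n} {λ _ → ∑ {n} λ _ → 1ℚ} {λ _ → N} (λ _ → trans (∑-const n 1ℚ) (ℚ.*-identityʳ N)) ⟨
      (∑ {n} λ _ → ∑ {n} λ _ → 1ℚ)
        ≡⟨ ∑∑-split k (λ _ _ → 1ℚ) (λ _ _ → refl) (λ _ → refl) ⟩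
      (∑ λ x → ∑ λ y → coefficient G k x y * 1ℚ) + (∑ λ x → ∑ λ y → coefficient G k x y * 1ℚ) + N
        ≡⟨ cong (λ q → q + q + N) (seq-edgeSum G (λ _ _ → 1ᴿ) k) ⟨
      W + W + N ∎
    triple : ι 3 * P ≡ ι 2 * ι (suc n) * W
    triple = begin
      ι 3 * P
        ≡⟨ cong (_* P) ι-3 ⟩
      3ℚ * P
        ≡⟨ solve 2 (λ P N → con 3ℚ :* P := con ½ :* (con 3ℚ :* (P :+ P :+ N) :- con 3ℚ :* N)) refl P N ⟩
      ½ * (3ℚ * (P + P + N) - 3ℚ * N)
        ≡⟨ cong (λ q → ½ * (q - 3ℚ * N)) (trans sizes (cong (λ q → 2ℚ * (N * q) + N) weights)) ⟩
      ½ * (2ℚ * (N * (W + W + N)) + N - 3ℚ * N)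
        ≡⟨ solve 2 (λ W N → con ½ :* (con 2ℚ :* (N :* (W :+ W :+ N)) :+ N :- con 3ℚ :* N)
             := con ½ :* (con 4ℚ :* (N :* W) :+ con 2ℚ :* (N :* N) :- con 2ℚ :* N)) refl W N ⟩
      ½ * (4ℚ * (N * W) + 2ℚ * (N * N) - 2ℚ * N)
        ≡⟨ cong (λ q → ½ * (4ℚ * (N * W) + 2ℚ * q - 2ℚ * N)) weights ⟩
      ½ * (4ℚ * (N * W) + 2ℚ * (W + W + N) - 2ℚ * N)
        ≡⟨ solve 2 (λ W N → con ½ :* (con 4ℚ :* (N :* W) :+ con 2ℚ :* (W :+ W :+ N) :- con 2ℚ :* N)
             := con 2ℚ :* (con 1ℚ :+ N) :* W) refl W N ⟩
      2ℚ * (1ℚ + N) * W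
        ≡⟨ cong₂ (λ p q → p * q * W) (sym ι-2) (trans (cong (_+ N) (sym ι-1)) (sym (ι-+ 1 n))) ⟩
      ι 2 * ι (suc n) * W ∎

-- Ultrametrics with natural values

fromℕ-suc≰0 : ∀ k → ¬ fromℕ (suc k) ≤ᴿ 0ᴿ
fromℕ-suc≰0 k k≤0 = ≤ᴿ⇒≯ᴿ {fromℕ 1} {0ᴿ}
  (≤ᴿ-trans {fromℕ 1} {fromℕ (suc k)} {0ᴿ} (fromℕ-mono-≤ {1} {suc k} (ℕ.s≤s ℕ.z≤n)) k≤0) 0<1ᴿ

fromℕ≤0⇒≡0 : ∀ k → fromℕ k ≤ᴿ 0ᴿ → k ≡ 0
fromℕ≤0⇒≡0 zero    _   = refl
fromℕ≤0⇒≡0 (suc k) k≤0 = contradiction k≤0 (fromℕ-suc≰0 k)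

record IsℕUltrametric (v : Fin n → Fin n → ℕ) : Set where
  field
    diagonal      : ∀ x → v x x ≡ 0
    indiscernible : ∀ x y → v x y ≡ 0 → x ≡ y
    symmetric     : ∀ x y → v x y ≡ v y x
    ultra         : ∀ x y z → v x y ≤ v x z ⊎ v x y ≤ v z y

fromℕᵐ : (Fin n → Fin n → ℕ) → Fin n → Fin n → ℝ
fromℕᵐ v x y = fromℕ (v x y)

fromℕ-≤-+ᴿ : ∀ a b c → a ≤ b ℕ.+ c → fromℕ a ≤ᴿ fromℕ b +ᴿ fromℕ c
fromℕ-≤-+ᴿ a b c a≤b+c = ≤⇒≤ᴿ {fromℕ a} {fromℕ b +ᴿ fromℕ c} (always λ _ →
  subst₂ ℚ._≤_ (sym (ι-/ a)) (trans (ι-+ b c) (sym (cong₂ _+_ (ι-/ b) (ι-/ c)))) (ι-mono-≤ a≤b+c))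

isUltrametric : ∀ {v : Fin n → Fin n → ℕ} → IsℕUltrametric v → IsUltrametric (fromℕᵐ v)
isUltrametric {n} {v} um = record
  { isSemiMetric = record
    { isQuasiSemiMetric = record
      { isPreMetric = record
        { isProtoMetric = record
          { isPartialOrder  = ≤ᴿ-isPartialOrder
          ; ≈-isEquivalence = isEquivalence
          ; cong            = λ { {x} {_} {y} refl refl → ≈ᴿ-refl {fromℕ (v x y)} }
          ; nonNegative     = λ {x} {y} → fromℕ-mono-≤ {0} {v x y} ℕ.z≤n
          }
        ; ≈⇒0 = λ { {x} refl → fromℕ-cong (v x x) 0 (diagonal x) }
        }
      ; 0⇒≈ = λ {x} {y} v≈0 → indiscernible x y (fromℕ≤0⇒≡0 (v x y) (≈ᴿ⇒≤ᴿ {fromℕ (v x y)} {0ᴿ} v≈0))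
      }
    ; sym = λ x y → fromℕ-cong (v x y) (v y x) (symmetric x y)
    }
  ; triangle = λ x y z → fromℕ-≤-+ᴿ (v x z) (v x y) (v y z) ([ (λ p → ℕ.≤-trans p (ℕ.m≤m+n (v x y) (v y z)))
                                     , (λ p → ℕ.≤-trans p (ℕ.m≤n+m (v y z) (v x y))) ]′ (ultra x z y))
  } , λ x y z → ≤⇒≤ᴿ {fromℕ (v x y)} {fromℕ (v x z) ⊔ᴿ fromℕ (v z y)} (always λ _ → maximum (v x y) (v x z) (v z y) (ultra x y z))
  where
  open IsℕUltrametric um
  fromℕ-cong : ∀ k l → k ≡ l → fromℕ k ≈ᴿ fromℕ l
  fromℕ-cong k .k refl = ≈ᴿ-refl {fromℕ k}
  maximum : ∀ a b c → a ≤ b ⊎ a ≤ c → (ℤ.+ a / 1) ℚ.≤ (ℤ.+ b / 1) ⊔ (ℤ.+ c / 1)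
  maximum a b c (inj₁ a≤b) = ℚ.≤-trans (subst₂ ℚ._≤_ (sym (ι-/ a)) (sym (ι-/ b)) (ι-mono-≤ a≤b)) (ℚ.p≤p⊔q (ℤ.+ b / 1) (ℤ.+ c / 1))
  maximum a b c (inj₂ a≤c) = ℚ.≤-trans (subst₂ ℚ._≤_ (sym (ι-/ a)) (sym (ι-/ c)) (ι-mono-≤ a≤c)) (ℚ.p≤q⊔p (ℤ.+ b / 1) (ℤ.+ c / 1))

-- The scale `M` is 1 for the optimum on the complete graph; set to a bound on all distances, it
-- provides a dominating ultrametric on any connected graph.
discrete : ℕ → Fin n → Fin n → ℕ
discrete M x y = if does (x Fin.≟ y) then 0 else M

discrete-refl : ∀ M (x : Fin n) → discrete M x x ≡ 0
discrete-refl M x rewrite dec-true (x Fin.≟ x) refl = refl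

discrete-≢ : ∀ M {x y : Fin n} → x ≢ y → discrete M x y ≡ M
discrete-≢ M {x} {y} x≢y rewrite dec-false (x Fin.≟ y) x≢y = refl

discrete≤ : ∀ M (x y : Fin n) → discrete M x y ≤ M
discrete≤ M x y with x Fin.≟ y
... | yes _ = ℕ.z≤n
... | no _  = ℕ.≤-refl

discrete-isℕUltrametric : ∀ M → IsℕUltrametric (discrete {n} (suc M))
discrete-isℕUltrametric M = record
  { diagonal      = discrete-refl (suc M)
  ; indiscernible = separated
  ; symmetric     = symm
  ; ultra         = ultra′
  }
  where
  separated : ∀ x y → discrete (suc M) x y ≡ 0 → x ≡ y
  separated x y v≡0 with x Fin.≟ y
  ... | yes x≡y = x≡y
  symm : ∀ x y → discrete (suc M) x y ≡ discrete (suc M) y x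
  symm x y with x Fin.≟ y
  ... | yes refl = sym (discrete-refl (suc M) x)
  ... | no x≢y   = sym (discrete-≢ (suc M) (≢-sym x≢y))
  ultra′ : ∀ x y z → discrete (suc M) x y ≤ discrete (suc M) x z ⊎ discrete (suc M) x y ≤ discrete (suc M) z y
  ultra′ x y z with x Fin.≟ z
  ... | yes refl = inj₂ ℕ.≤-refl
  ... | no _     = inj₁ (discrete≤ (suc M) x y)

-- Both optima of the complete graph

caterpillar : (Fin (suc m) → Fin n) → Tree n
caterpillar {zero}  f = leaf (f zero)
caterpillar {suc m} f = node (leaf (f zero)) (caterpillar (f ∘ suc))

leaves-caterpillar : ∀ (f : Fin (suc m) → Fin n) → leaves (caterpillar f) ≡ tabulate f
leaves-caterpillar {zero}  f = refl
leaves-caterpillar {suc m} f = cong (f zero ∷_) (leaves-caterpillar (f ∘ suc))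

hierarchy : ∃ (IsHierarchy {suc m})
hierarchy {m} = caterpillar id , ↭-reflexive (leaves-caterpillar id)

complete-connected : ∀ n → Connected (complete n)
complete-connected n x y with x Fin.≟ y
... | yes refl = 0 , here
... | no x≢y   = 1 , step x≢y here

complete-distance≤ : ∀ M {x y : Fin n} {k} → IsDistance (complete n) x y k → k ≤ discrete (suc M) x y
complete-distance≤ M {x} {y} (_ , shortest) with x Fin.≟ y
... | yes refl = shortest 0 here
... | no x≢y   = ℕ.≤-trans (shortest 1 (step x≢y here)) (ℕ.s≤s ℕ.z≤n)

complete-OPT-D : ∀ n → ∃ (IsHierarchy {n}) → IsOPT-D (complete n) (factor n *ᴿ totalWeight (complete n))
complete-OPT-D n (T₀ , T₀↭) =
  (T₀ , T₀↭ , cost≈ T₀ T₀↭) ,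
  λ T T↭ → ≈ᴿ⇒≤ᴿ {D} {dasguptaCost G T} (≈ᴿ-sym {dasguptaCost G T} {D} (cost≈ T T↭))
  where
  G = complete n
  D = factor n *ᴿ totalWeight G
  cost≈ : ∀ T → IsHierarchy T → dasguptaCost G T ≈ᴿ D
  cost≈ T T↭ = ≡⇒≈ᴿ {dasguptaCost G T} {D} (always (dasguptaCost-complete n T T↭))

complete-OPT-free : ∀ n → IsOPT-free (complete n) (totalWeight (complete n))
complete-OPT-free n =
  (fromℕᵐ (discrete 1) , (isUltrametric (discrete-isℕUltrametric 0) , dominates) ,
    ≤ᴿ-antisym {edgeSum G (fromℕᵐ (discrete 1))} {totalWeight G}
      (edgeSum-mono-≤ G {fromℕᵐ (discrete 1)} {λ _ _ → 1ᴿ} λ {x} {y} _ → fromℕ-mono-≤ {discrete 1 x y} {1} (discrete≤ 1 x y))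
      (totalWeight≤edgeSum G {fromℕᵐ (discrete 1)} dominates)) ,
  λ u (_ , dom) → totalWeight≤edgeSum G {u} dom
  where
  G = complete n
  dominates : DominatesDistance G (fromℕᵐ (discrete 1))
  dominates x y k dist = fromℕ-mono-≤ {k} {discrete 1 x y} (complete-distance≤ 0 dist)

-- Past the threshold F is at least ε₀, so the truncation inside the reciprocal has no effect and
-- the terms agree exactly.
*/-cancel : ∀ c F (F>0 : 0ᴿ <ᴿ F) → (fromℚ c *ᴿ F) /ᴿ F [ F>0 ] ≈ᴿ fromℚ c
*/-cancel c F (ε₀ , 0<ε₀ , F≥ε₀) = ≡⇒≈ᴿ {(fromℚ c *ᴿ F) /ᴿ F [ ε₀ , 0<ε₀ , F≥ε₀ ]} {fromℚ c}
  (eventually-map (λ {k} → cancel (seq F k)) F≥ε₀)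
  where
  cancel : ∀ q → 0ℚ + ε₀ ℚ.≤ q → c * q * recipMax 0<ε₀ q ≡ c
  cancel q ε₀≤q = trans (ℚ.*-assoc c q (recipMax 0<ε₀ q)) (trans (cong (c *_)
    (trans (cong (_* recipMax 0<ε₀ q) (sym (ℚ.p≥q⇒p⊔q≡p (subst (ℚ._≤ q) (ℚ.+-identityˡ ε₀) ε₀≤q)))) (recipMax-inverse 0<ε₀ q)))
    (ℚ.*-identityʳ c))

complete-ratio : ∀ n → ∃ (IsHierarchy {n}) → ∀ {x y : Fin n} → x ≢ y → IsRatio (complete n) (factor n)
complete-ratio n T {x} {y} x≢y =
  factor n *ᴿ W , W , complete-OPT-D n T , complete-OPT-free n , W>0 , */-cancel (φ n) W W>0
  where
  W = totalWeight (complete n)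
  W>0 : 0ᴿ <ᴿ W
  W>0 = totalWeight-pos (complete n) {x} {y} x≢y

-- Existence of the optima

-- Double negation commutes with a finite conjunction; this assembles the floors of all entries of a
-- matrix.
¬¬-∀ : {P : Fin n → Set} → (∀ i → ¬ ¬ P i) → ¬ ¬ (∀ i → P i)
¬¬-∀ {zero}  _ ¬all = ¬all λ ()
¬¬-∀ {suc n} p ¬all = p zero λ p₀ → ¬¬-∀ (p ∘ suc) λ p₊ → ¬all λ { zero → p₀ ; (suc i) → p₊ i }

-- The goal is a negation, so finitely many classical case distinctions are permitted: whether P
-- holds anywhere in the tail, whether it holds at zero, and how `f zero` compares with the minimum
-- of the tail.
¬¬-minimum : (P : Fin n → Set) (f : Fin n → ℝ) → ∃ P →
  ¬ ¬ ∃ λ i → P i × ∀ j → P j → f i ≤ᴿ f j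
¬¬-minimum {suc n} P f (i , pi) none = ¬¬-excluded-middle λ where
    (yes p₊) → ¬¬-minimum (P ∘ suc) (f ∘ suc) p₊ λ (j , pj , j≤) → ¬¬-excluded-middle λ where
      (yes p₀) → ¬¬≤ᴿ⊎>ᴿ (f zero) (f (suc j)) (none ∘ λ where
        (inj₁ 0≤j) → zero , p₀ , λ where
          zero    _  → ≤ᴿ-refl {f zero}
          (suc k) pk → ≤ᴿ-trans {f zero} {f (suc j)} {f (suc k)} 0≤j (j≤ k pk)
        (inj₂ j<0) → suc j , pj , λ where
          zero    _  → ≮ᴿ⇒≥ᴿ {f (suc j)} {f zero} λ 0<j → <ᴿ-asym {f zero} {f (suc j)} 0<j j<0
          (suc k) pk → j≤ k pk)
      (no ¬p₀) → none (suc j , pj , λ where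
        zero    p₀ → contradiction p₀ ¬p₀
        (suc k) pk → j≤ k pk)
    (no ¬p₊) → none (only ¬p₊ i pi)
  where
  <ᴿ-asym : ∀ {x y} → x <ᴿ y → ¬ y <ᴿ x
  <ᴿ-asym {x} {y} (ε , 0<ε , x<y) = ≤ᴿ⇒≯ᴿ {x} {y} (≤⇒≤ᴿ {x} {y} (eventually-map
    (λ {k} → ℚ.≤-trans (subst (ℚ._≤ seq x k + ε) (ℚ.+-identityʳ (seq x k)) (ℚ.+-monoʳ-≤ (seq x k) (ℚ.<⇒≤ 0<ε)))) x<y))
  only : ¬ ∃ (P ∘ suc) → ∀ i → P i → ∃ λ i → P i × ∀ j → P j → f i ≤ᴿ f j
  only ¬p₊ zero    p₀ = zero , p₀ , λ where
    zero    _  → ≤ᴿ-refl {f zero}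
    (suc j) pj → contradiction (j , pj) ¬p₊
  only ¬p₊ (suc i) pi = contradiction (i , pi) ¬p₊

upperBound : ∀ (f : Fin n → ℕ) → ∃ λ M → ∀ i → f i ≤ M
upperBound {zero}  f = 0 , λ ()
upperBound {suc n} f =
  let M , f≤M = upperBound (f ∘ suc)
  in f zero ℕ.⊔ M , λ where
       zero    → ℕ.m≤m⊔n (f zero) M
       (suc i) → ℕ.≤-trans (f≤M i) (ℕ.m≤n⊔m (f zero) M)

module _ (G : WeightedGraph n) where

  -- The matrices with entries at most M are indexed by Fin ((suc M ^ n) ^ n).
  ¬¬-minimum-bounded : ∀ {A : Set} {M} (P : A → Set) (v : A → Fin n → Fin n → ℕ) →
    (∀ a → P a → ∀ x y → v a x y ≤ M) → ∃ P →
    ¬ ¬ ∃ λ a → P a × ∀ b → P b → edgeSum G (fromℕᵐ (v a)) ≤ᴿ edgeSum G (fromℕᵐ (v b))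
  ¬¬-minimum-bounded {A} {M} P v v≤M (a , pa) none =
    ¬¬-minimum Q cost (encode a pa , realised a pa) λ (i , (b , pb , vb≡i) , i≤) →
      none (b , pb , λ c pc →
        ≤ᴿ-trans {edgeSum G (fromℕᵐ (v b))} {cost i} {edgeSum G (fromℕᵐ (v c))}
          (edgeSum-mono-≤ G {fromℕᵐ (v b)} {fromℕᵐ (decode i)} λ {x} {y} _ → fromℕ-mono-≤ {v b x y} {decode i x y} (ℕ.≤-reflexive (vb≡i x y)))
          (≤ᴿ-trans {cost i} {cost (encode c pc)} {edgeSum G (fromℕᵐ (v c))} (i≤ (encode c pc) (realised c pc))
            (edgeSum-mono-≤ G {fromℕᵐ (decode (encode c pc))} {fromℕᵐ (v c)} λ {x} {y} _ →
              fromℕ-mono-≤ {decode (encode c pc) x y} {v c x y} (ℕ.≤-reflexive (sym (decode-encode c pc x y))))))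
    where
    decode : Fin ((suc M ℕ.^ n) ℕ.^ n) → Fin n → Fin n → ℕ
    decode i x y = Fin.toℕ (Fin.finToFun {suc M} {n} (Fin.finToFun {suc M ℕ.^ n} {n} i x) y)
    cost : Fin ((suc M ℕ.^ n) ℕ.^ n) → ℝ
    cost i = edgeSum G (fromℕᵐ (decode i))
    -- The type `A` may be infinite; a code competes only together with an admissible element that
    -- realises it, and that element is what the minimum returns.
    Q : Fin ((suc M ℕ.^ n) ℕ.^ n) → Set
    Q i = ∃ λ a → P a × ∀ x y → v a x y ≡ decode i x y
    entry : ∀ a → P a → Fin n → Fin n → Fin (suc M)
    entry a pa x y = Fin.fromℕ< (ℕ.s≤s (v≤M a pa x y))
    encode : ∀ a → P a → Fin ((suc M ℕ.^ n) ℕ.^ n)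
    encode a pa = Fin.funToFin (λ x → Fin.funToFin (entry a pa x))
    decode-encode : ∀ a pa x y → v a x y ≡ decode (encode a pa) x y
    decode-encode a pa x y = sym (trans
      (cong (λ c → Fin.toℕ (Fin.finToFun {suc M} {n} c y)) (Fin.finToFun-funToFin (λ x → Fin.funToFin (entry a pa x)) x))
      (trans (cong Fin.toℕ (Fin.finToFun-funToFin (entry a pa x) y)) (Fin.toℕ-fromℕ< (ℕ.s≤s (v≤M a pa x y)))))
    realised : ∀ a pa → Q (encode a pa)
    realised a pa = a , pa , decode-encode a pa

length-cluster≤ : ∀ (T : Tree n) x y → length (cluster T x y) ≤ length (leaves T)
length-cluster≤ (leaf z)   x y = ℕ.≤-refl
length-cluster≤ (node l r) x y with does (both∈? x y l) | does (both∈? x y r)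
... | true  | _     = ℕ.≤-trans (length-cluster≤ l x y) (subst (length (leaves l) ≤_) (sym (List.length-++ (leaves l))) (ℕ.m≤m+n _ _))
... | false | true  = ℕ.≤-trans (length-cluster≤ r x y) (subst (length (leaves r) ≤_) (sym (List.length-++ (leaves l))) (ℕ.m≤n+m _ _))
... | false | false = ℕ.≤-refl

¬¬-OPT-D : ∀ (G : WeightedGraph n) → ∃ (IsHierarchy {n}) → ¬ ¬ ∃ (IsOPT-D G)
¬¬-OPT-D G hierarchy none = ¬¬-minimum-bounded G IsHierarchy (λ T x y → length (cluster T x y))
  (λ T T↭ x y → subst (length (cluster T x y) ≤_) (hierarchy-length T T↭) (length-cluster≤ T x y)) hierarchy
  λ (T , T↭ , T≤) → none (dasguptaCost G T , (T , T↭ , ≈ᴿ-refl {dasguptaCost G T}) , T≤)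

-- k is the integer part of r truncated at M.
IsFloor : ℕ → ℝ → ℕ → Set
IsFloor M r k = fromℕ k ≤ᴿ r × k ≤ M × (k ≡ M ⊎ r <ᴿ fromℕ (suc k))

-- Raising the truncation level affects only a value that sits at the old level, and then a single
-- comparison of r with the next integer settles it.
¬¬-floor : ∀ M {r} → 0ᴿ ≤ᴿ r → ¬ ¬ ∃ (IsFloor M r)
¬¬-floor zero    0≤r none = none (0 , 0≤r , ℕ.z≤n , inj₁ refl)
¬¬-floor (suc M) {r} 0≤r none = ¬¬-floor M {r} 0≤r λ where
  (k , k≤r , k≤M , inj₂ r<k+1)    → none (k , k≤r , ℕ.m≤n⇒m≤1+n k≤M , inj₂ r<k+1)
  (k , k≤r , k≤M , inj₁ refl)     → ¬¬≤ᴿ⊎>ᴿ (fromℕ (suc k)) r λ where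
    (inj₁ k+1≤r) → none (suc k , k+1≤r , ℕ.≤-refl , inj₁ refl)
    (inj₂ r<k+1) → none (k , k≤r , ℕ.m≤n⇒m≤1+n k≤M , inj₂ r<k+1)

-- Integers below r stay below its floor; domination, separation of points and symmetry pass to the
-- rounded matrix in this way.
floor-greatest : ∀ {M} r k j → IsFloor M r k → j ≤ M → fromℕ j ≤ᴿ r → j ≤ k
floor-greatest r k j (_ , _ , inj₁ refl) j≤M _ = j≤M
floor-greatest r k j (_ , _ , inj₂ r<k+1) _ j≤r = ℕ.≮⇒≥ λ k<j →
  ≤ᴿ⇒≯ᴿ {fromℕ (suc k)} {r} (≤ᴿ-trans {fromℕ (suc k)} {fromℕ j} {r} (fromℕ-mono-≤ {suc k} {j} k<j) j≤r) r<k+1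

floor-< : ∀ {M} r k j → IsFloor M r k → k ℕ.< j → j ≤ M → r <ᴿ fromℕ j
floor-< r k j (_ , _ , inj₁ refl)  k<j j≤M = contradiction j≤M (ℕ.<⇒≱ k<j)
floor-< r k j (_ , _ , inj₂ r<k+1) k<j _   = <ᴿ-≤ᴿ-trans {r} {fromℕ (suc k)} {fromℕ j} r<k+1 (fromℕ-mono-≤ {suc k} {j} k<j)

module _ (G : WeightedGraph n) (connected : Connected G) where

  -- A length that is attained while no shorter one is would be the distance. Were there none,
  -- strong induction would exclude walks of every length, against connectedness.
  ¬¬-distance : ∀ x y → ¬ ¬ ∃ (IsDistance G x y)
  ¬¬-distance x y none = <-rec (λ k → ¬ Walk G x y k)
    (λ k shorter w → none (k , w , λ j w′ → ℕ.≮⇒≥ λ j<k → shorter j<k w′))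
    (proj₁ (connected x y)) (proj₂ (connected x y))

  -- The walks supplied by connectedness bound all distances. The successor keeps the bound
  -- positive, so that the discrete matrix of that scale separates points and truncation there
  -- preserves the value 1.
  diameterBound : ∃ λ M → ∀ {x y k} → IsDistance G x y k → k ≤ suc M
  diameterBound =
    let M , walk≤M = upperBound λ x → proj₁ (upperBound λ y → proj₁ (connected x y))
    in M , λ {x} {y} {k} (_ , shortest) → ℕ.≤-trans (shortest _ (proj₂ (connected x y)))
         (ℕ.≤-trans (proj₂ (upperBound λ y → proj₁ (connected x y)) y) (ℕ.≤-trans (walk≤M x) (ℕ.n≤1+n M)))

  IsCandidate : ℕ → (Fin n → Fin n → ℕ) → Set
  IsCandidate M v = IsℕUltrametric v × (∀ x y k → IsDistance G x y k → k ≤ v x y) × ∀ x y → v x y ≤ M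

  -- Distances are integers, so rounding down preserves domination, and
  -- monotone maps preserve the ultrametric inequality.
  ¬¬-floor-candidate : ∀ {M} → (∀ {x y k} → IsDistance G x y k → k ≤ suc M) →
    ∀ {u} → IsUltrametric u → DominatesDistance G u →
    ¬ ¬ ∃ λ v → IsCandidate (suc M) v × ∀ x y → fromℕ (v x y) ≤ᴿ u x y
  ¬¬-floor-candidate {M} distance≤M {u} (metric , u-ultra) dom none =
    ¬¬-∀ (λ x → ¬¬-∀ λ y → ¬¬-floor (suc M) {u x y} u-nonneg) λ floors → none (candidate floors)
    where
    open IsGeneralMetric metric using (≈⇒0) renaming (sym to u-sym; nonNegative to u-nonneg)
    -- Without this, rounding down could identify distinct points. The distance behind it exists
    -- only under a double negation, which stability of `≤ᴿ` removes.
    one≤ : ∀ {x y} → x ≢ y → fromℕ 1 ≤ᴿ u x y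
    one≤ {x} {y} x≢y = ≤ᴿ-stable {fromℕ 1} {u x y} λ ¬1≤u → ¬¬-distance x y λ where
      (zero  , here , _)  → x≢y refl
      (suc k , dist)      → ¬1≤u (≤ᴿ-trans {fromℕ 1} {fromℕ (suc k)} {u x y} (fromℕ-mono-≤ {1} {suc k} (ℕ.s≤s ℕ.z≤n)) (dom x y (suc k) dist))
    candidate : (∀ x y → ∃ (IsFloor (suc M) (u x y))) →
      ∃ λ v → IsCandidate (suc M) v × ∀ x y → fromℕ (v x y) ≤ᴿ u x y
    candidate floors = v , (record
      { diagonal      = λ x → fromℕ≤0⇒≡0 (v x x) (≤ᴿ-trans {fromℕ (v x x)} {u x x} {0ᴿ} (v≤u x x) (≈ᴿ⇒≤ᴿ {u x x} {0ᴿ} (≈⇒0 refl)))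
      ; indiscernible = separated
      ; symmetric     = λ x y → ℕ.≤-antisym (v-sym≤ x y) (v-sym≤ y x)
      ; ultra         = ultra
      } , (λ x y k dist → floor-greatest (u x y) (v x y) k (isFloor x y) (distance≤M dist) (dom x y k dist)) , v≤M) , v≤u
      where
      v : Fin n → Fin n → ℕ
      v x y = proj₁ (floors x y)
      isFloor : ∀ x y → IsFloor (suc M) (u x y) (v x y)
      isFloor x y = proj₂ (floors x y)
      v≤u : ∀ x y → fromℕ (v x y) ≤ᴿ u x y
      v≤u x y = proj₁ (isFloor x y)
      v≤M : ∀ x y → v x y ≤ suc M
      v≤M x y = proj₁ (proj₂ (isFloor x y))
      separated : ∀ x y → v x y ≡ 0 → x ≡ y
      separated x y v≡0 = decidable-stable (x Fin.≟ y) λ x≢y → ℕ.<-irrefl (sym v≡0)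
        (floor-greatest (u x y) (v x y) 1 (isFloor x y) (ℕ.s≤s ℕ.z≤n) (one≤ x≢y))
      v-sym≤ : ∀ x y → v x y ≤ v y x
      v-sym≤ x y = floor-greatest (u y x) (v y x) (v x y) (isFloor y x) (v≤M x y)
        (≤ᴿ-trans {fromℕ (v x y)} {u x y} {u y x} (v≤u x y) (≈ᴿ⇒≤ᴿ {u x y} {u y x} (u-sym x y)))
      ultra : ∀ x y z → v x y ≤ v x z ⊎ v x y ≤ v z y
      ultra x y z = compare (v x y ℕ.≤? v x z) (v x y ℕ.≤? v z y)
        where
        compare : Dec (v x y ≤ v x z) → Dec (v x y ≤ v z y) → v x y ≤ v x z ⊎ v x y ≤ v z y
        compare (yes p) _       = inj₁ p
        compare (no _)  (yes q) = inj₂ q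
        -- If the integer `v x y` exceeded both floors, it would exceed both `u x z` and `u z y`
        -- themselves, although it is at most `u x y`, which is bounded by their maximum.
        compare (no ¬p) (no ¬q) = contradiction
          (⊔ᴿ-<ᴿ {u x z} {u z y} {fromℕ (v x y)}
            (floor-< (u x z) (v x z) (v x y) (isFloor x z) (ℕ.≰⇒> ¬p) (v≤M x y))
            (floor-< (u z y) (v z y) (v x y) (isFloor z y) (ℕ.≰⇒> ¬q) (v≤M x y)))
          (≤ᴿ⇒≯ᴿ {fromℕ (v x y)} {u x z ⊔ᴿ u z y}
            (≤ᴿ-trans {fromℕ (v x y)} {u x y} {u x z ⊔ᴿ u z y} (v≤u x y) (u-ultra x y z)))

  -- A cheapest bounded integer candidate is optimal among all admissible ultrametrics, since each
  -- of these lies above a candidate, its truncated floor, which costs no more.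
  ¬¬-OPT-free : ¬ ¬ ∃ (IsOPT-free G)
  ¬¬-OPT-free none = ¬¬-minimum-bounded G (IsCandidate (suc M)) id (λ _ (_ , _ , v≤M) → v≤M)
    (discrete (suc M) , discrete-isℕUltrametric M , discrete-dominates , discrete≤ (suc M))
    λ (v , (v-ultra , v-dom , _) , v≤) → none (cost v ,
      (fromℕᵐ v , (isUltrametric v-ultra , λ x y k dist → fromℕ-mono-≤ {k} {v x y} (v-dom x y k dist)) , ≈ᴿ-refl {cost v}) ,
      λ u (u-ultra , u-dom) → ≤ᴿ-stable {cost v} {edgeSum G u} λ ¬v≤u →
        ¬¬-floor-candidate {M} distance≤M {u} u-ultra u-dom λ (v′ , v′-candidate , v′≤u) →
          ¬v≤u (≤ᴿ-trans {cost v} {cost v′} {edgeSum G u} (v≤ v′ v′-candidate)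
            (edgeSum-mono-≤ G {fromℕᵐ v′} {u} λ {x} {y} _ → v′≤u x y)))
    where
    M = proj₁ diameterBound
    distance≤M : ∀ {x y k} → IsDistance G x y k → k ≤ suc M
    distance≤M = proj₂ diameterBound
    cost : (Fin n → Fin n → ℕ) → ℝ
    cost v = edgeSum G (fromℕᵐ v)
    discrete-dominates : ∀ x y k → IsDistance G x y k → k ≤ discrete (suc M) x y
    discrete-dominates x y k dist = by-cases (x Fin.≟ y)
      where
      by-cases : Dec (x ≡ y) → k ≤ discrete (suc M) x y
      by-cases (yes refl) = ℕ.≤-trans (proj₂ dist 0 here) ℕ.z≤n
      by-cases (no x≢y)   = subst (k ≤_) (sym (discrete-≢ (suc M) x≢y)) (distance≤M dist)

connected⇒edge : ∀ (G : WeightedGraph n) → Connected G → ∀ {x y} → x ≢ y → ∃ λ z → WeightedGraph.Edge G x z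
connected⇒edge G connected {x} {y} x≢y = first (proj₂ (connected x y))
  where
  first : ∀ {k} → Walk G x y k → ∃ λ z → WeightedGraph.Edge G x z
  first here       = contradiction refl x≢y
  first (step e _) = _ , e

¬¬-ratio : ∀ (G : WeightedGraph n) → Connected G → ∃ (IsHierarchy {n}) → ∀ {x y : Fin n} → x ≢ y → ¬ ¬ ∃ (IsRatio G)
¬¬-ratio G connected T {x} x≢y none =
  ¬¬-OPT-D G T λ (D , optD) → ¬¬-OPT-free G connected λ (F , optF) →
    let z , e = connected⇒edge G connected x≢y
        F>0 = <ᴿ-≤ᴿ-trans {0ᴿ} {totalWeight G} {F} (totalWeight-pos G {x} {z} e) (totalWeight≤OPT-free G {F} optF)
    in none (D /ᴿ F [ F>0 ] , D , F , optD , optF , F>0 , ≈ᴿ-refl {D /ᴿ F [ F>0 ]})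

corollary8 : (n : ℕ) → 2 ≤ n →
    ((G : WeightedGraph n) → Connected G →
    (¬ ¬ ∃ (IsRatio G)) × (∀ ρ → IsRatio G ρ → ρ ≤ᴿ factor n))
    × (Connected (complete n) × IsRatio (complete n) (factor n))
    × (∀ c → ((G : WeightedGraph n) → Connected G → ∀ ρ → IsRatio G ρ → ρ ≤ᴿ c) →
    factor n ≤ᴿ c)
corollary8 n@(suc (suc m)) (ℕ.s≤s (ℕ.s≤s _)) =
  (λ G connected → ¬¬-ratio G connected hierarchy 0≢1 , λ ρ → ratio≤factor G {ρ}) ,
  (complete-connected n , ratio) ,
  λ c bound → bound (complete n) (complete-connected n) (factor n) ratio
  where
  0≢1 : zero ≢ suc {suc m} zero
  0≢1 ()
  ratio : IsRatio (complete n) (factor n)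
  ratio = complete-ratio n hierarchy 0≢1
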